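{- Let $\varrho$ be a primitive, bijective substitution with expansion factor $Q$ on a finite alphabet $\mathcal{A}$. Assume that $k$ is a positive integer such that the word $a^{k+1}$ is not in the language of $\varrho$ for any letter $a\in\mathcal{A}$. Let $v\in\mathcal{A}^{\mathbb{Z}}$ be a repetitive fixed point of $\varrho$, let $X_v$ be the orbit closure of $v$ under the shift, and let $\mu$ be the unique shift-invariant probability measure on $X_v$. For $n>0$ and $a\in\mathcal{A}$ put \[ C_{n,a}=\{u\in X_{v}\mid u_{0}=u_{n}=u_{2n}=\cdots =u_{kn}=a\}. \] Then the following hold. (1) For some $n>0$ and some $a\in\mathcal{A}$, $\mu(C_{n,a})>0$. If $\mu(C_{n,a})>0$ and $n=Q^{s}n'$ for some integers $s\geq 0$ and $n'>0$, then $\mu(C_{n',b})>0$ for some $b\in\mathcal{A}$. Moreover, if $\mu(C_{n,a})>0$ and $m$ is such that for each letter $c\in\mathcal{A}$ the word $\varrho^{m}(c)$ contains all letters of $\mathcal{A}$, then $\mu(C_{Q^{m}n,b})>0$ for each letter $b\in\mathcal{A}$. (2) Suppose that $a\in\mathcal{A}$ and $n>0$ are such that $\mu(C_{n,a})>0$, and that $n$ and $Q$ are coprime. Then there is $m_{0}>0$ such that, for all $m>m_{0}$, there are no arithmetic progressions of the letter $a$ in $v$ with difference $d=Q^{m}+n$ or $d=Q^m-n$ and length $L=Q^{m}+k$. (3) Suppose that the cardinality of $\mathcal{A}$ is $2$. Then there are positive integers $n$ and $m_0$ such that, for all integers $s\geq 0$ and $m\geq m_0$, and for every letter of $\mathcal{A}$,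 there are no arithmetic progressions of that letter in $v$ with difference $Q^{m+s}+ Q^sn$ or $Q^{m+s}-Q^sn$ and length $Q^m+k$.
   Context: A substitution $\varrho$ on a finite alphabet $\mathcal{A}$ assigns to each letter a non-empty finite word and is extended to finite and bi-infinite words by concatenation. It has constant length (expansion factor) $Q$ if $|\varrho(a)|=Q$ for all $a\in\mathcal{A}$. A substitution of constant length $Q$ is bijective if, for every $0\le j<Q$, the map $a\mapsto \varrho(a)_j$ (the letter of $\varrho(a)$ at position $j$) is a bijection of $\mathcal{A}$. It is primitive if there is $m\geq 1$ such that $\varrho^m(a)$ contains every letter of $\mathcal{A}$, for every $a\in\mathcal{A}$. The language of $\varrho$ is the set of all finite words occurring as factors of some $\varrho^m(a)$, $a\in\mathcal{A}$, $m\in\mathbb{N}$. A bi-infinite fixed point $v=(v_i)_{i\in\mathbb{Z}}$ satisfies $\varrho(v)=v$, where $\varrho(v_0)$ occupies positions $0,\dots,Q-1$; it is repetitive if every factor of $v$ recurs in $v$ with bounded gaps. The orbit closure is taken in the product topology on $\mathcal{A}^{\mathbb{Z}}$ with respect to the shift map $T$, $(Tu)_i=u_{i+1}$. An arithmetic progression of the letter $a$ in $v$ with difference $d$ and length $L$ means that there is $t\in\mathbb{Z}$ with $v_t=v_{t+d}=\dots=v_{t+(L-1)d}=a$.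
   Formalization: The expansion factor is taken to satisfy Q ≥ 2; for Q = 1 primitivity forces a one-letter alphabet with a ↦ a, where v is constant, a^{k+1} is never in the language, and part (2) fails. -}

module Defs where

open import Data.Fin.Base using (Fin; toℕ)
open import Data.Integer.Base as ℤ using (ℤ; +_; 1ℤ; ∣_∣)
import Data.Integer.Properties as ℤ
open import Data.List.Base using (List; []; _∷_; concatMap)
open import Data.List.Membership.Propositional using (_∈_)
open import Data.List.Relation.Binary.Infix.Heterogeneous using (Infix)
open import Data.Nat.Base as ℕ using (ℕ; zero; suc; _⊓_)
open import Data.Nat.GeneralisedArithmetic using (fold)
import Data.Nat.Properties as ℕ
open import Data.Product using (∃-syntax; Σ-syntax; _×_; _,_)
open import Data.Rational.Base as ℚ using (ℚ; 0ℚ; 1ℚ; ½)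
import Data.Rational.Properties as ℚ
open import Data.Rational.Solver using (module +-*-Solver)
open import Data.Vec.Base using (Vec; lookup; toList)
open import Function.Base using (_∘_)
open import Function.Definitions using (Bijective)
open import Level using (0ℓ)
open import Relation.Binary.PropositionalEquality
  using (_≡_; _≢_; refl; sym; trans; cong; subst)
open import Relation.Unary using (Pred; U; ∁; ⋃; ⋂; _⊥_; _≐_)

-- Cauchy sequences of rationals, to be compared with _≈ℝ_ rather than _≡_.
record ℝ : Set where
  constructor mkℝ
  field
    seq    : ℕ → ℚ
    cauchy : ∀ ε → 0ℚ ℚ.< ε →
             ∃[ N ] (∀ m n → N ℕ.≤ m → N ℕ.≤ n → ℚ.∣ seq m ℚ.- seq n ∣ ℚ.< ε)

open ℝ public

private
  halve-pos : ∀ {ε} → 0ℚ ℚ.< ε → 0ℚ ℚ.< ½ ℚ.* ε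
  halve-pos {ε} 0<ε =
    subst (ℚ._< ½ ℚ.* ε) (ℚ.*-zeroʳ ½) (ℚ.*-monoʳ-<-pos ½ 0<ε)

  halves : ∀ ε → ½ ℚ.* ε ℚ.+ ½ ℚ.* ε ≡ ε
  halves ε = trans (sym (ℚ.*-distribʳ-+ ε ½ ½)) (ℚ.*-identityˡ ε)

  interchange : ∀ a b c d →
    (a ℚ.+ b) ℚ.- (c ℚ.+ d) ≡ (a ℚ.- c) ℚ.+ (b ℚ.- d)
  interchange = solve 4 (λ a b c d →
    (a :+ b) :- (c :+ d) := (a :- c) :+ (b :- d)) refl
    where open +-*-Solver

fromℚ : ℚ → ℝ
fromℚ q = mkℝ (λ _ → q) λ ε 0<ε → 0 , λ _ _ _ _ →
  subst (λ d → ℚ.∣ d ∣ ℚ.< ε) (sym (ℚ.+-inverseʳ q)) 0<ε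

0ℝ 1ℝ : ℝ
0ℝ = fromℚ 0ℚ
1ℝ = fromℚ 1ℚ

infixl 6 _+ℝ_
infix  4 _≤ℝ_ _<ℝ_ _≈ℝ_

_+ℝ_ : ℝ → ℝ → ℝ
seq    (x +ℝ y) n     = seq x n ℚ.+ seq y n
cauchy (x +ℝ y) ε 0<ε
  with M , p ← cauchy x (½ ℚ.* ε) (halve-pos 0<ε)
     | N , q ← cauchy y (½ ℚ.* ε) (halve-pos 0<ε)
  = M ℕ.⊔ N , λ m n M⊔N≤m M⊔N≤n → begin-strict
      ℚ.∣ (seq x m ℚ.+ seq y m) ℚ.- (seq x n ℚ.+ seq y n) ∣
        ≡⟨ cong ℚ.∣_∣ (interchange (seq x m) (seq y m) (seq x n) (seq y n)) ⟩
      ℚ.∣ (seq x m ℚ.- seq x n) ℚ.+ (seq y m ℚ.- seq y n) ∣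
        ≤⟨ ℚ.∣p+q∣≤∣p∣+∣q∣ (seq x m ℚ.- seq x n) (seq y m ℚ.- seq y n) ⟩
      ℚ.∣ seq x m ℚ.- seq x n ∣ ℚ.+ ℚ.∣ seq y m ℚ.- seq y n ∣
        <⟨ ℚ.+-mono-< (p m n (ℕ.m⊔n≤o⇒m≤o M N M⊔N≤m) (ℕ.m⊔n≤o⇒m≤o M N M⊔N≤n))
                      (q m n (ℕ.m⊔n≤o⇒n≤o M N M⊔N≤m) (ℕ.m⊔n≤o⇒n≤o M N M⊔N≤n)) ⟩
      ½ ℚ.* ε ℚ.+ ½ ℚ.* ε
        ≡⟨ halves ε ⟩
      ε ∎
  where open ℚ.≤-Reasoning

_≤ℝ_ : ℝ → ℝ → Set
x ≤ℝ y = ∀ ε → 0ℚ ℚ.< ε → ∃[ N ] (∀ n → N ℕ.≤ n → seq x n ℚ.≤ seq y n ℚ.+ ε)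

_<ℝ_ : ℝ → ℝ → Set
x <ℝ y = ∃[ ε ] (0ℚ ℚ.< ε × ∃[ N ] (∀ n → N ℕ.≤ n → seq x n ℚ.+ ε ℚ.≤ seq y n))

_≈ℝ_ : ℝ → ℝ → Set
x ≈ℝ y = x ≤ℝ y × y ≤ℝ x

partialSum : (ℕ → ℝ) → ℕ → ℝ
partialSum x zero    = 0ℝ
partialSum x (suc n) = partialSum x n +ℝ x n

_ConvergesTo_ : (ℕ → ℝ) → ℝ → Set
s ConvergesTo x = ∀ ε → 0ℚ ℚ.< ε → ∃[ N ] (∀ n → N ℕ.≤ n →
  (x ≤ℝ s n +ℝ fromℚ ε) × (s n ≤ℝ x +ℝ fromℚ ε))

-- The σ-algebra generated by a family of subsets. Closure under countable
-- intersections and under extensional equality is classically redundant,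
-- but has to be asked for constructively.

data σ-Generated {I X : Set} (G : I → Pred X 0ℓ) : Pred X 0ℓ → Set₁ where
  generator    : ∀ i → σ-Generated G (G i)
  whole        : σ-Generated G U
  complement   : ∀ {S} → σ-Generated G S → σ-Generated G (∁ S)
  union        : ∀ {S : ℕ → Pred X 0ℓ} →
                 (∀ n → σ-Generated G (S n)) → σ-Generated G (⋃ ℕ S)
  intersection : ∀ {S : ℕ → Pred X 0ℓ} →
                 (∀ n → σ-Generated G (S n)) → σ-Generated G (⋂ ℕ S)
  respects     : ∀ {S S′} → S ≐ S′ → σ-Generated G S → σ-Generated G S′

record ProbabilityMeasure {I X : Set} (G : I → Pred X 0ℓ) : Set₁ where
  field
    measure     : ∀ {S} → σ-Generated G S → ℝ
    -- In particular the measure of S does not depend on the derivation of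
    -- measurability.
    measure-≐   : ∀ {S S′} (b : σ-Generated G S) (b′ : σ-Generated G S′) →
                  S ≐ S′ → measure b ≈ℝ measure b′
    nonNegative : ∀ {S} (b : σ-Generated G S) → 0ℝ ≤ℝ measure b
    normalised  : measure whole ≈ℝ 1ℝ
    σ-additive  : ∀ {S : ℕ → Pred X 0ℓ} (b : ∀ n → σ-Generated G (S n)) →
                  (∀ {i j} → i ≢ j → S i ⊥ S j) →
                  partialSum (λ n → measure (b n)) ConvergesTo measure (union b)

open ProbabilityMeasure public

Substitution : Set → ℕ → Set
Substitution A Q = A → Vec A Q

module _ {A : Set} {Q : ℕ} (ϱ : Substitution A Q) where

  extend : List A → List A
  extend = concatMap (toList ∘ ϱ)

  power : ℕ → A → List A
  power m a = fold (a ∷ []) extend m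

  IsBijective : Set
  IsBijective = ∀ (j : Fin Q) → Bijective _≡_ _≡_ (λ a → lookup (ϱ a) j)

  IsPrimitive : Set
  IsPrimitive = ∃[ m ] (1 ℕ.≤ m × (∀ a b → b ∈ power m a))

  InLanguage : List A → Set
  InLanguage w = ∃[ a ] ∃[ m ] Infix _≡_ w (power m a)

  -- ϱ(v) has the word ϱ(v_q) at the positions qQ, …, qQ + Q - 1.
  IsFixedPoint : (ℤ → A) → Set
  IsFixedPoint v = ∀ (q : ℤ) (j : Fin Q) →
    v (q ℤ.* + Q ℤ.+ + toℕ j) ≡ lookup (ϱ (v q)) j

module _ {A : Set} where

  -- Every factor (given by its position i and its length l) recurs with
  -- gaps bounded by some R.
  IsRepetitive : (ℤ → A) → Set
  IsRepetitive v = ∀ (i : ℤ) (l : ℕ) → ∃[ R ] (∀ (j : ℤ) → ∃[ p ]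
    (j ℤ.≤ p × p ℤ.≤ j ℤ.+ + R ×
     (∀ x → x ℕ.< l → v (p ℤ.+ + x) ≡ v (i ℤ.+ + x))))

  HasProgression : (ℤ → A) → A → (d : ℤ) (L : ℕ) → Set
  HasProgression v a d L =
    ∃[ t ] (∀ i → i ℕ.< L → v (t ℤ.+ + i ℤ.* d) ≡ a)

  shift : (ℤ → A) → (ℤ → A)
  shift u i = u (i ℤ.+ 1ℤ)

  -- u is in the closure of { Tʲ v | j ∈ ℤ }: the sets of words agreeing with
  -- u on a window [-N, N] form a neighbourhood base at u in the product
  -- topology.
  InOrbitClosure : (v u : ℤ → A) → Set
  InOrbitClosure v u = ∀ (N : ℕ) → ∃[ j ]
    (∀ i → ∣ i ∣ ℕ.≤ N → u i ≡ v (i ℤ.+ j))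

  shift-closed : ∀ v u → InOrbitClosure v u → InOrbitClosure v (shift u)
  shift-closed v u u∈ N with j , agree ← u∈ (N ℕ.+ 1) =
    1ℤ ℤ.+ j , λ i ∣i∣≤N →
      trans (agree (i ℤ.+ 1ℤ)
              (ℕ.≤-trans (ℤ.∣i+j∣≤∣i∣+∣j∣ i 1ℤ) (ℕ.+-monoˡ-≤ 1 ∣i∣≤N)))
            (cong v (ℤ.+-assoc i 1ℤ j))

module _ {A : Set} (v : ℤ → A) where

  OrbitClosure : Set
  OrbitClosure = Σ[ u ∈ (ℤ → A) ] InOrbitClosure v u

  T : OrbitClosure → OrbitClosure
  T (u , u∈) = shift u , shift-closed v u u∈

  Cylinder : ℤ × A → Pred OrbitClosure 0ℓ
  Cylinder (i , a) (u , _) = u i ≡ a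

  -- For a finite alphabet, the topology of X_v has a countable base of finite
  -- intersections of these cylinders, so they generate the Borel σ-algebra.
  Borel : Pred OrbitClosure 0ℓ → Set₁
  Borel = σ-Generated Cylinder

  T⁻¹-borel : ∀ {S} → Borel S → Borel (S ∘ T)
  T⁻¹-borel (generator (i , a))        = generator (i ℤ.+ 1ℤ , a)
  T⁻¹-borel whole                      = whole
  T⁻¹-borel (complement b)             = complement (T⁻¹-borel b)
  T⁻¹-borel (union b)                  = union (λ n → T⁻¹-borel (b n))
  T⁻¹-borel (intersection b)           = intersection (λ n → T⁻¹-borel (b n))
  T⁻¹-borel (respects (S⊆S′ , S′⊆S) b) =
    respects ((λ {x} → S⊆S′ {T x}) , (λ {x} → S′⊆S {T x})) (T⁻¹-borel b)

  IsShiftInvariant : ProbabilityMeasure Cylinder → Set₁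
  IsShiftInvariant μ = ∀ {S} (b : Borel S) → measure μ (T⁻¹-borel b) ≈ℝ measure μ b

  C : (k n : ℕ) (a : A) → Pred OrbitClosure 0ℓ
  C k n a (u , _) = ∀ j → j ℕ.≤ k → u (+ (j ℕ.* n)) ≡ a

  C-borel : ∀ k n a → Borel (C k n a)
  C-borel k n a = respects
    ( (λ {(u , _)} h j j≤k →
         subst (λ i → u (+ (i ℕ.* n)) ≡ a) (ℕ.m≤n⇒m⊓n≡m j≤k) (h j))
    , (λ h j → h (j ⊓ k) (ℕ.m⊓n≤n j k)))
    (intersection (λ j → generator (+ ((j ⊓ k) ℕ.* n) , a)))

{-# OPTIONS --safe #-}
module Submission where

-- By repetitivity, X_v is covered by finitely many translates of C_{n,a} as soon
-- as v contains a progression of k + 1 letters a with difference n, so that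
-- μ(C_{n,a}) > 0 exactly when v contains one. (For the direction producing the
-- progression from the measure, its existence is decidable, since all factors of
-- v of a given length occur in an effectively bounded window.)
--
-- The columns of ϱᵏ are permutations of the r letters, and so have order dividing
-- M = r!. For i < B = Qᵏ, the integer i (1 + B + ⋯ + Bᴹ⁻¹) has M equal base-B
-- digits i, so the corresponding column of ϱᵏᴹ is an M-th power, hence the
-- identity. Thus n = 1 + B + ⋯ + Bᴹ⁻¹, which is coprime to Q, is the difference of
-- a progression of k + 1 ≤ B letters a for every letter a. This yields the
-- existence in (1) and, with the argument of (2), also (3).
--
-- A long progression with difference Qᵐ ± n as in (2) has k + 1 consecutive terms
-- in consecutive blocks ϱᵐ(v_q), …, ϱᵐ(v_{q+k}), at positions at which ϱᵐ(v_0)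
-- also has the letter a. As the columns of ϱᵐ are injective, v_q = ⋯ = v_{q+k},
-- which is impossible.

open import Defs
open import Algebra.Bundles using (CommutativeMonoid)
open import Data.Empty using (⊥-elim)
open import Data.Fin.Base as Fin using (Fin; toℕ)
import Data.Fin.Properties as Fin
open import Data.Integer.Base as ℤ using (ℤ; +_; 0ℤ; 1ℤ; ∣_∣)
open import Data.Integer.DivMod using (a≡a%ℕn+[a/ℕn]*n; n%ℕd<d)
import Data.Integer.Properties as ℤ
open import Data.Integer.Tactic.RingSolver using (solve-∀)
open import Data.List.Base using (List; []; _∷_; _++_; replicate; applyUpTo)
open import Data.List.Membership.Propositional using (_∈_)
open import Data.List.Membership.Propositional.Properties using (∈-applyUpTo⁻)
open import Data.List.Relation.Binary.Infix.Heterogeneous using (Infix; MkView; fromView)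
import Data.List.Relation.Binary.Pointwise as Pointwise
open import Data.Nat.Base as ℕ using (ℕ; zero; suc; _+_; _*_; _^_; _∸_; _≤_; _<_; z≤n; s≤s; NonZero; _!)
open import Data.Nat.Coprimality using (Coprime; coprime-Bézout)
open import Data.Nat.Divisibility
  using (divides; ∣-trans; ∣1⇒≡1; ∣m+n∣m⇒∣n; ∣m⇒∣m*n; ∣n⇒∣m*n; m∣m*n; m≤n⇒m!∣n!)
open import Data.Nat.DivMod using (_/_; _mod_; m≡m%n+[m/n]*n; m%n<n; m<n*o⇒m/o<n)
open import Data.Nat.GCD using (module Bézout)
open import Data.Nat.GeneralisedArithmetic using (fold; fold-+)
import Data.Nat.Properties as ℕ
open import Data.Nat.Solver using (module +-*-Solver)
open import Data.Product using (∃-syntax; _×_; _,_; proj₁; proj₂)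
open import Data.Rational.Base as ℚ using (ℚ; 0ℚ; ½)
import Data.Rational.Properties as ℚ
open import Data.Sum.Base using (_⊎_; inj₁; inj₂)
open import Data.Unit.Base using (tt)
open import Data.Vec.Base using (Vec; []; _∷_; lookup; toList)
open import Function.Base using (_∘_)
open import Function.Bundles using (_↔_; module Inverse; module Injection)
open import Function.Definitions using (Injective)
open import Function.Properties.Inverse using (↔⇒↣)
open import Level using (0ℓ)
open import Relation.Binary.Definitions using (DecidableEquality; tri<; tri≈; tri>)
open import Relation.Binary.PropositionalEquality
  using (_≡_; _≢_; refl; sym; trans; cong; cong₂; subst; subst₂; module ≡-Reasoning)
open import Relation.Nullary using (¬_; Dec; yes; no)
open import Relation.Nullary.Decidable using (_×-dec_; ¬?; via-injection)
open import Relation.Unary using (Pred; U; ∅; ∁; _∩_; ⋃; _⊆_; _⊥_; _≐_; Decidable)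

-- Sums of reals and measures of covers

private
  half-pos : ∀ {ε} → 0ℚ ℚ.< ε → 0ℚ ℚ.< ½ ℚ.* ε
  half-pos {ε} 0<ε = subst (ℚ._< ½ ℚ.* ε) (ℚ.*-zeroʳ ½) (ℚ.*-monoʳ-<-pos ½ 0<ε)

  halves : ∀ ε → ½ ℚ.* ε ℚ.+ ½ ℚ.* ε ≡ ε
  halves ε = trans (sym (ℚ.*-distribʳ-+ ε ½ ½)) (ℚ.*-identityˡ ε)

  p≤p+ε : ∀ p {ε} → 0ℚ ℚ.< ε → p ℚ.≤ p ℚ.+ ε
  p≤p+ε p {ε} 0<ε = subst (ℚ._≤ p ℚ.+ ε) (ℚ.+-identityʳ p) (ℚ.+-monoʳ-≤ p (ℚ.<⇒≤ 0<ε))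

  add-halves : ∀ p ε → (p ℚ.+ ½ ℚ.* ε) ℚ.+ ½ ℚ.* ε ≡ p ℚ.+ ε
  add-halves p ε = trans (ℚ.+-assoc p (½ ℚ.* ε) (½ ℚ.* ε)) (cong (p ℚ.+_) (halves ε))

infix 4 _≼_
infixl 6 _⊕_

-- _≤ℝ_ on bare sequences, so that comparisons never involve Cauchy moduli;
-- a record, so that s and t can be inferred.
record _≼_ (s t : ℕ → ℚ) : Set where
  constructor ≼⁺
  field ≼⁻ : ∀ ε → 0ℚ ℚ.< ε → ∃[ N ] (∀ n → N ≤ n → s n ℚ.≤ t n ℚ.+ ε)
open _≼_

_⊕_ : (s t : ℕ → ℚ) → ℕ → ℚ
(s ⊕ t) n = s n ℚ.+ t n

pointwise⇒≼ : ∀ {x y} → (∀ n → x n ℚ.≤ y n) → x ≼ y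
pointwise⇒≼ {y = y} x≤y = ≼⁺ λ ε 0<ε → 0 , λ n _ → ℚ.≤-trans (x≤y n) (p≤p+ε (y n) 0<ε)

≼-refl : ∀ {x} → x ≼ x
≼-refl = pointwise⇒≼ (λ _ → ℚ.≤-refl)

≼-trans : ∀ {x y z} → x ≼ y → y ≼ z → x ≼ z
≼-trans {x} {y} {z} (≼⁺ x≤y) (≼⁺ y≤z) = ≼⁺ λ ε 0<ε →
  let M , p = x≤y (½ ℚ.* ε) (half-pos 0<ε)
      N , q = y≤z (½ ℚ.* ε) (half-pos 0<ε)
  in M ℕ.⊔ N , λ n M⊔N≤n → begin
      x n                           ≤⟨ p n (ℕ.m⊔n≤o⇒m≤o M N M⊔N≤n) ⟩
      y n ℚ.+ ½ ℚ.* ε               ≤⟨ ℚ.+-monoˡ-≤ (½ ℚ.* ε) (q n (ℕ.m⊔n≤o⇒n≤o M N M⊔N≤n)) ⟩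
      (z n ℚ.+ ½ ℚ.* ε) ℚ.+ ½ ℚ.* ε ≡⟨ add-halves (z n) ε ⟩
      z n ℚ.+ ε                     ∎
  where open ℚ.≤-Reasoning

⊕-mono : ∀ x x′ y y′ → x ≼ x′ → y ≼ y′ → x ⊕ y ≼ x′ ⊕ y′
⊕-mono x x′ y y′ (≼⁺ x≤x′) (≼⁺ y≤y′) = ≼⁺ λ ε 0<ε →
  let M , p = x≤x′ (½ ℚ.* ε) (half-pos 0<ε)
      N , q = y≤y′ (½ ℚ.* ε) (half-pos 0<ε)
  in M ℕ.⊔ N , λ n M⊔N≤n → begin
      x n ℚ.+ y n
        ≤⟨ ℚ.+-mono-≤ (p n (ℕ.m⊔n≤o⇒m≤o M N M⊔N≤n)) (q n (ℕ.m⊔n≤o⇒n≤o M N M⊔N≤n)) ⟩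
      (x′ n ℚ.+ ½ ℚ.* ε) ℚ.+ (y′ n ℚ.+ ½ ℚ.* ε)
        ≡⟨ interchange (x′ n) (½ ℚ.* ε) (y′ n) (½ ℚ.* ε) ⟩
      (x′ n ℚ.+ y′ n) ℚ.+ (½ ℚ.* ε ℚ.+ ½ ℚ.* ε)
        ≡⟨ cong (x′ n ℚ.+ y′ n ℚ.+_) (halves ε) ⟩
      (x′ n ℚ.+ y′ n) ℚ.+ ε ∎
  where
  open ℚ.≤-Reasoning
  open import Algebra.Properties.CommutativeSemigroup
    (CommutativeMonoid.commutativeSemigroup ℚ.+-0-commutativeMonoid) using (interchange)

≼-approximate : ∀ x y → (∀ ε → 0ℚ ℚ.< ε → x ≼ y ⊕ (λ _ → ε)) → x ≼ y
≼-approximate x y x≤y+ = ≼⁺ λ ε 0<ε →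
  let N , p = ≼⁻ (x≤y+ (½ ℚ.* ε) (half-pos 0<ε)) (½ ℚ.* ε) (half-pos 0<ε)
  in N , λ n N≤n → subst (x n ℚ.≤_) (add-halves (y n) ε) (p n N≤n)

x+0≼x : ∀ x → x ⊕ (λ _ → 0ℚ) ≼ x
x+0≼x x = pointwise⇒≼ (λ n → ℚ.≤-reflexive (ℚ.+-identityʳ (x n)))

0≼y⇒x≼y+x : ∀ x y → (λ _ → 0ℚ) ≼ y → x ≼ y ⊕ x
0≼y⇒x≼y+x x y 0≤y = ≼-trans
  (pointwise⇒≼ (λ n → ℚ.≤-reflexive (sym (ℚ.+-identityˡ (x n))))) (⊕-mono (λ _ → 0ℚ) y x x 0≤y ≼-refl)

0≼y⇒x≼x+y : ∀ x y → (λ _ → 0ℚ) ≼ y → x ≼ x ⊕ y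
0≼y⇒x≼x+y x y 0≤y = ≼-trans
  (pointwise⇒≼ (λ n → ℚ.≤-reflexive (sym (ℚ.+-identityʳ (x n))))) (⊕-mono x x (λ _ → 0ℚ) y ≼-refl 0≤y)

⊕-cancelˡ : ∀ x y z → x ⊕ y ≼ x ⊕ z → y ≼ z
⊕-cancelˡ x y z (≼⁺ x+y≤x+z) = ≼⁺ λ ε 0<ε →
  let N , p = x+y≤x+z ε 0<ε
  in N , λ n N≤n → begin
      y n                                       ≡⟨ cancel (x n) (y n) ⟨
      ℚ.- x n ℚ.+ (x n ℚ.+ y n)         ≤⟨ ℚ.+-monoʳ-≤ (ℚ.- x n) (p n N≤n) ⟩
      ℚ.- x n ℚ.+ ((x n ℚ.+ z n) ℚ.+ ε) ≡⟨ cong (ℚ.- x n ℚ.+_) (ℚ.+-assoc (x n) (z n) ε) ⟩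
      ℚ.- x n ℚ.+ (x n ℚ.+ (z n ℚ.+ ε)) ≡⟨ cancel (x n) (z n ℚ.+ ε) ⟩
      z n ℚ.+ ε                                 ∎
  where
  open ℚ.≤-Reasoning
  open import Algebra.Properties.Group ℚ.+-0-group using () renaming (\\-leftDividesʳ to cancel)

<ℝ⇒⋠ : ∀ x y → x <ℝ y → ¬ (seq y ≼ seq x)
<ℝ⇒⋠ x y (ε , 0<ε , M , p) (≼⁺ y≤x)
  with N , q ← y≤x (½ ℚ.* ε) (half-pos 0<ε)
  = ℚ.<-irrefl refl (begin-strict
      seq y n                           ≤⟨ q n (ℕ.m≤n⊔m M N) ⟩
      seq x n ℚ.+ ½ ℚ.* ε               ≡⟨ ℚ.+-identityʳ (seq x n ℚ.+ ½ ℚ.* ε) ⟨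
      (seq x n ℚ.+ ½ ℚ.* ε) ℚ.+ 0ℚ      <⟨ ℚ.+-monoʳ-< (seq x n ℚ.+ ½ ℚ.* ε) (half-pos 0<ε) ⟩
      (seq x n ℚ.+ ½ ℚ.* ε) ℚ.+ ½ ℚ.* ε ≡⟨ add-halves (seq x n) ε ⟩
      seq x n ℚ.+ ε                     ≤⟨ p n (ℕ.m≤m⊔n M N) ⟩
      seq y n                           ∎)
  where
  open ℚ.≤-Reasoning
  n = M ℕ.⊔ N

partialSum-mono : ∀ x y n → (∀ i → i < n → seq (x i) ≼ seq (y i)) →
                  seq (partialSum x n) ≼ seq (partialSum y n)
partialSum-mono x y zero    x≤y = ≼-refl
partialSum-mono x y (suc n) x≤y =
  ⊕-mono (seq (partialSum x n)) (seq (partialSum y n)) (seq (x n)) (seq (y n))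
    (partialSum-mono x y n (λ i i<n → x≤y i (ℕ.m<n⇒m<1+n i<n))) (x≤y n ℕ.≤-refl)

partialSum-nonNegative : ∀ x → (∀ i → seq 0ℝ ≼ seq (x i)) →
                         ∀ n → seq 0ℝ ≼ seq (partialSum x n)
partialSum-nonNegative x 0≤x zero    = ≼-refl
partialSum-nonNegative x 0≤x (suc n) =
  ≼-trans (0≤x n) (0≼y⇒x≼y+x (seq (x n)) (seq (partialSum x n)) (partialSum-nonNegative x 0≤x n))

head≼partialSum : ∀ x → (∀ i → seq 0ℝ ≼ seq (x i)) →
                  ∀ n → seq (x 0) ≼ seq (partialSum x (suc n))
head≼partialSum x 0≤x zero    = 0≼y⇒x≼y+x (seq (x 0)) (seq 0ℝ) ≼-refl
head≼partialSum x 0≤x (suc n) = ≼-trans (head≼partialSum x 0≤x n)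
  (0≼y⇒x≼x+y (seq (partialSum x (suc n))) (seq (x (suc n))) (0≤x (suc n)))

partialSum-truncate : ∀ x K → (∀ i → K ≤ i → seq (x i) ≼ seq 0ℝ) →
                      ∀ n → seq (partialSum x (n + K)) ≼ seq (partialSum x K)
partialSum-truncate x K x≤0 zero    = ≼-refl
partialSum-truncate x K x≤0 (suc n) = ≼-trans
  (⊕-mono (seq (partialSum x (n + K))) (seq (partialSum x K)) (seq (x (n + K))) (seq 0ℝ)
    (partialSum-truncate x K x≤0 n) (x≤0 (n + K) (ℕ.m≤n+m K n)))
  (x+0≼x (seq (partialSum x K)))

private
  -- By induction on `K`: either the last copy of `c` is already at least half of `h`, or the
  -- remaining copies sum to at least half of `h`. The bound `δ` is chosen before `c` and `n`, so
  -- that it is uniform along the sequence, as `_<ℝ_` demands.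
  pigeonhole-δ : ∀ K {h} → 0ℚ ℚ.< h → ∃[ δ ] (0ℚ ℚ.< δ ×
    (∀ c n → h ℚ.≤ seq (partialSum (λ _ → c) K) n → δ ℚ.≤ seq c n))
  pigeonhole-δ zero    {h} 0<h = h , 0<h , λ _ _ h≤0 → ⊥-elim (ℚ.<-irrefl refl (ℚ.<-≤-trans 0<h h≤0))
  pigeonhole-δ (suc K) {h} 0<h with δ , 0<δ , bound ← pigeonhole-δ K (half-pos 0<h) =
    δ ℚ.⊓ (½ ℚ.* h) , positive-⊓ , λ c n h≤ → case c n h≤ (ℚ.≤-total (½ ℚ.* h) (seq c n))
    where
    positive-⊓ : 0ℚ ℚ.< δ ℚ.⊓ (½ ℚ.* h)
    positive-⊓ with ℚ.⊓-sel δ (½ ℚ.* h)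
    ... | inj₁ eq = subst (0ℚ ℚ.<_) (sym eq) 0<δ
    ... | inj₂ eq = subst (0ℚ ℚ.<_) (sym eq) (half-pos 0<h)
    case : ∀ c n → h ℚ.≤ seq (partialSum (λ _ → c) K) n ℚ.+ seq c n →
           ½ ℚ.* h ℚ.≤ seq c n ⊎ seq c n ℚ.≤ ½ ℚ.* h → δ ℚ.⊓ (½ ℚ.* h) ℚ.≤ seq c n
    case c n h≤ (inj₁ ½h≤c) = ℚ.≤-trans (ℚ.p⊓q≤q δ (½ ℚ.* h)) ½h≤c
    case c n h≤ (inj₂ c≤½h) = ℚ.≤-trans (ℚ.p⊓q≤p δ (½ ℚ.* h)) (bound c n (ℚ.≮⇒≥ λ s<½h →
      ℚ.<-irrefl refl (begin-strict
        h                                                ≤⟨ h≤ ⟩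
        seq (partialSum (λ _ → c) K) n ℚ.+ seq c n       <⟨ ℚ.+-mono-<-≤ s<½h c≤½h ⟩
        ½ ℚ.* h ℚ.+ ½ ℚ.* h                              ≡⟨ halves h ⟩
        h                                                ∎)))
      where open ℚ.≤-Reasoning

-- With tolerance ½, the `K`-fold sum is eventually at least ½, and `pigeonhole-δ` turns this into
-- one positive lower bound for all late terms of `c`.
1≼multiple⇒positive : ∀ {c} K → seq 1ℝ ≼ seq (partialSum (λ _ → c) K) → 0ℝ <ℝ c
1≼multiple⇒positive {c} K (≼⁺ 1≤Kc)
  with N , p ← 1≤Kc ½ (ℚ.positive⁻¹ ½)
     | δ , 0<δ , bound ← pigeonhole-δ K {½} (ℚ.positive⁻¹ ½)
  = δ , 0<δ , N , λ n N≤n →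
      subst (ℚ._≤ seq c n) (sym (ℚ.+-identityˡ δ))
        (bound c n (ℚ.≮⇒≥ λ s<½ → ℚ.<-irrefl refl (ℚ.≤-<-trans (p n N≤n) (ℚ.+-monoˡ-< ½ s<½))))

-- Null sets, monotonicity and finite covers for a probability measure.

module _ {I X : Set} {G : I → Pred X 0ℓ} where

  ∩-generated : ∀ {S S′} → σ-Generated G S → σ-Generated G S′ → σ-Generated G (S ∩ S′)
  ∩-generated {S} {S′} b b′ = respects
    ((λ h → h 0 , h 1) , λ { (x∈S , x∈S′) zero → x∈S ; (x∈S , x∈S′) (suc _) → x∈S′ })
    (intersection {S = family} λ { zero → b ; (suc _) → b′ })
    where
    family : ℕ → Pred X 0ℓ
    family zero    = S
    family (suc _) = S′

  module _ (μ : ProbabilityMeasure G) where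

    measure-cong : ∀ {S S′} (b : σ-Generated G S) (b′ : σ-Generated G S′) →
                   S ≐ S′ → seq (measure μ b) ≼ seq (measure μ b′)
    measure-cong b b′ S≐S′ = ≼⁺ (proj₁ (measure-≐ μ b b′ S≐S′))

    measure-nonNegative : ∀ {S} (b : σ-Generated G S) → seq 0ℝ ≼ seq (measure μ b)
    measure-nonNegative b = ≼⁺ (nonNegative μ b)

    measure-union : ∀ {S : ℕ → Pred X 0ℓ} (b : ∀ n → σ-Generated G (S n)) →
                    (∀ {i j} → i ≢ j → S i ⊥ S j) → ∀ ε → 0ℚ ℚ.< ε →
                    ∃[ N ] (∀ n → N ≤ n →
                      seq (measure μ (union b)) ≼ seq (partialSum (measure μ ∘ b) n) ⊕ (λ _ → ε) ×
                      seq (partialSum (measure μ ∘ b) n) ≼ seq (measure μ (union b)) ⊕ (λ _ → ε))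
    measure-union b disjoint ε 0<ε with N , converges ← σ-additive μ b disjoint ε 0<ε =
      N , λ n N≤n → ≼⁺ (proj₁ (converges n N≤n)) , ≼⁺ (proj₂ (converges n N≤n))

    -- An empty set is disjoint from itself, so the constant family `S`, `S`, ... is disjoint with
    -- union `S`. Additivity then bounds twice the measure of `S` by the measure plus `ε`, and one
    -- copy cancels.
    measure-empty : ∀ {S} (b : σ-Generated G S) → S ⊆ ∅ → seq (measure μ b) ≼ seq 0ℝ
    measure-empty b S⊆∅ = ≼-approximate m (seq 0ℝ) λ ε 0<ε →
      let N , converges = measure-union (λ _ → b) (λ _ (x∈S , _) → S⊆∅ x∈S) ε 0<ε
          0≼ = partialSum-nonNegative (λ _ → measure μ b) (λ _ → measure-nonNegative b) N
      in ≼-trans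
           -- Of the `2 + N` copies in the partial sum, the first `N` contribute a non-negative
           -- amount, which leaves two copies of `m`.
           (⊕-cancelˡ m m (λ _ → ε)
             (≼-trans (⊕-mono m (copies (suc N)) m m (0≼y⇒x≼y+x m (copies N) 0≼) ≼-refl)
               (≼-trans (proj₂ (converges (2 + N) (ℕ.m≤n+m N 2)))
                 (⊕-mono (seq (measure μ (union (λ _ → b)))) m (λ _ → ε) (λ _ → ε) union≼ ≼-refl))))
           (0≼y⇒x≼y+x (λ _ → ε) (seq 0ℝ) ≼-refl)
      where
      m        = seq (measure μ b)
      copies   = λ n → seq (partialSum (λ _ → measure μ b) n)
      union≼   = measure-cong (union (λ _ → b)) b (proj₂ , (0 ,_))

    -- Additivity is applied to `S`, its complement in `S′`, and then empty sets. Decidability of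
    -- `S` is what makes the first two pieces exhaust `S′`.
    measure-⊆ : ∀ {S S′} (b : σ-Generated G S) (b′ : σ-Generated G S′) →
                Decidable S → S ⊆ S′ → seq (measure μ b) ≼ seq (measure μ b′)
    measure-⊆ {S} {S′} b b′ S? S⊆S′ =
      ≼-trans
        (≼-approximate (seq (measure μ b)) (seq (measure μ (union borel))) λ ε 0<ε →
          let N , converges = measure-union borel disjoint ε 0<ε
          in ≼-trans (head≼partialSum (measure μ ∘ borel) (measure-nonNegative ∘ borel) N)
                     (proj₂ (converges (suc N) (ℕ.n≤1+n N))))
        (measure-cong (union borel) b′ ((λ {x} → union⊆ {x}) , ⊆union))
      where
      family : ℕ → Pred X 0ℓ
      family 0             = S
      family 1             = S′ ∩ ∁ S
      family (suc (suc _)) = ∁ U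
      borel : ∀ i → σ-Generated G (family i)
      borel 0             = b
      borel 1             = ∩-generated b′ (complement b)
      borel (suc (suc _)) = complement whole
      disjoint : ∀ {i j} → i ≢ j → family i ⊥ family j
      disjoint {0}           {0}           i≢j _         = i≢j refl
      disjoint {0}           {1}           _   (p , q)   = proj₂ q p
      disjoint {1}           {0}           _   (p , q)   = proj₂ p q
      disjoint {1}           {1}           i≢j _         = i≢j refl
      disjoint {suc (suc _)} {_}           _   (p , _)   = p tt
      disjoint {0}           {suc (suc _)} _   (_ , q)   = q tt
      disjoint {1}           {suc (suc _)} _   (_ , q)   = q tt
      union⊆ : ⋃ ℕ family ⊆ S′
      union⊆ (0           , p) = S⊆S′ p
      union⊆ (1           , p) = proj₁ p
      union⊆ (suc (suc _) , p) = ⊥-elim (p tt)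
      ⊆union : S′ ⊆ ⋃ ℕ family
      ⊆union {x} x∈S′ with S? x
      ... | yes x∈S = 0 , x∈S
      ... | no  x∉S = 1 , x∈S′ , x∉S

    module _ {S : ℕ → Pred X 0ℓ} (b : ∀ i → σ-Generated G (S i)) (S? : ∀ i → Decidable (S i)) where

      private
        NoneBelow : ℕ → Pred X 0ℓ
        NoneBelow zero    = U
        NoneBelow (suc i) = NoneBelow i ∩ ∁ (S i)

        noneBelow-generated : ∀ i → σ-Generated G (NoneBelow i)
        noneBelow-generated zero    = whole
        noneBelow-generated (suc i) = ∩-generated (noneBelow-generated i) (complement (b i))

        First : ℕ → Pred X 0ℓ
        First i = S i ∩ NoneBelow i

        first-generated : ∀ i → σ-Generated G (First i)
        first-generated i = ∩-generated (b i) (noneBelow-generated i)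

        noneBelow⇒∉ : ∀ {i j x} → i < j → NoneBelow j x → ¬ S i x
        noneBelow⇒∉ {i} {suc j} (s≤s i≤j) (none , x∉Sj) with ℕ.m≤n⇒m<n∨m≡n i≤j
        ... | inj₁ i<j  = noneBelow⇒∉ i<j none
        ... | inj₂ refl = x∉Sj

        search : ∀ x i → NoneBelow i x ⊎ (∃[ j ] First j x)
        search x zero    = inj₁ tt
        search x (suc i) with search x i | S? i x
        ... | inj₂ found | _        = inj₂ found
        ... | inj₁ none  | yes x∈Si = inj₂ (i , x∈Si , none)
        ... | inj₁ none  | no  x∉Si = inj₁ (none , x∉Si)

        noneBelow? : ∀ i → Decidable (NoneBelow i)
        noneBelow? zero    x = yes tt
        noneBelow? (suc i) x = noneBelow? i x ×-dec ¬? (S? i x)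

        first? : ∀ i → Decidable (First i)
        first? i x = S? i x ×-dec noneBelow? i x

        disjoint : ∀ {i j} → i ≢ j → First i ⊥ First j
        disjoint {i} {j} i≢j ((x∈Si , none-i) , (x∈Sj , none-j)) with ℕ.<-cmp i j
        ... | tri< i<j _ _ = noneBelow⇒∉ i<j none-j x∈Si
        ... | tri≈ _ i≡j _ = i≢j i≡j
        ... | tri> _ _ j<i = noneBelow⇒∉ j<i none-i x∈Sj

      -- The sets `First i` of points whose least index is `i` are disjoint and measurable, exhaust
      -- the space by a bounded search, are contained in `S i`, and are empty from index `K` on.
      measure-cover : ∀ K → (∀ x → ∃[ i ] (i < K × S i x)) →
                      seq 1ℝ ≼ seq (partialSum (measure μ ∘ b) K)
      measure-cover K covers =
        ≼-approximate (seq 1ℝ) (seq (partialSum (measure μ ∘ b) K)) λ ε 0<ε →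
        let N , converges = measure-union first-generated disjoint ε 0<ε
            first = measure μ ∘ first-generated
        in ≼-trans (≼⁺ (proj₂ (normalised μ)))
          (≼-trans (measure-cong whole (union first-generated) ((λ {x} _ → hit x) , λ _ → tt))
            -- The index `N + K` is late enough for convergence and still truncates to the first `K`
            -- terms.
            (≼-trans (proj₁ (converges (N + K) (ℕ.m≤m+n N K)))
              (⊕-mono (seq (partialSum first (N + K))) (seq (partialSum (measure μ ∘ b) K))
                      (λ _ → ε) (λ _ → ε)
                (≼-trans (partialSum-truncate first K vanish N)
                  (partialSum-mono first (measure μ ∘ b) K λ i _ →
                    measure-⊆ (first-generated i) (b i) (first? i) proj₁))
                ≼-refl)))
        where
        hit : ∀ x → ∃[ j ] First j x
        hit x with search x K | covers x
        ... | inj₂ found | _              = found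
        ... | inj₁ none  | i , i<K , x∈Si = ⊥-elim (noneBelow⇒∉ i<K none x∈Si)
        vanish : ∀ i → K ≤ i → seq (measure μ (first-generated i)) ≼ seq 0ℝ
        vanish i K≤i = measure-empty (first-generated i) λ {x} (_ , none) →
          let j , j<K , x∈Sj = covers x in noneBelow⇒∉ (ℕ.<-≤-trans j<K K≤i) none x∈Sj

-- Columns of the powers of a bijective substitution

n<m^n : ∀ {m} → 2 ≤ m → ∀ n → n < m ^ n
n<m^n {m} 2≤m zero    = s≤s z≤n
n<m^n {m} 2≤m (suc n) = begin
  suc (suc n)           ≤⟨ s≤s (n<m^n 2≤m n) ⟩
  1 + m ^ n             ≤⟨ ℕ.+-monoˡ-≤ (m ^ n) (ℕ.≤-trans (s≤s z≤n) (n<m^n 2≤m n)) ⟩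
  m ^ n + m ^ n         ≡⟨ cong (_+_ (m ^ n)) (ℕ.+-identityʳ (m ^ n)) ⟨
  2 * m ^ n             ≤⟨ ℕ.*-monoˡ-≤ (m ^ n) 2≤m ⟩
  m * m ^ n             ∎
  where open ℕ.≤-Reasoning

-- Orders of permutations, repunits and finite words.

module _ {A : Set} {σ : A → A} (σ-injective : Injective _≡_ _≡_ σ) where

  fold-injective : ∀ n {a b} → fold a σ n ≡ fold b σ n → a ≡ b
  fold-injective zero    eq = eq
  fold-injective (suc n) eq = fold-injective n (σ-injective eq)

  private
    fold-multiple : ∀ {a d} → fold a σ d ≡ a → ∀ q → fold a σ (q * d) ≡ a
    fold-multiple         eq zero    = refl
    fold-multiple {a} {d} eq (suc q) =
      trans (fold-+ a σ d) (trans (cong (λ b → fold b σ d) (fold-multiple eq q)) eq)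

  -- Two of the first r + 1 iterates of `a` coincide. Cancelling the common iterations by
  -- injectivity gives a period of `a` between 1 and r, and such a period divides r!.
  fold-factorial : ∀ {r} → A ↔ Fin r → ∀ a → fold a σ (r !) ≡ a
  fold-factorial {r} A↔Fin a
    with i , j , i<j , eq ← Fin.pigeonhole (ℕ.n<1+n r) (λ i → Inverse.to A↔Fin (fold a σ (toℕ i)))
    = period (toℕ j ∸ toℕ i) (ℕ.m<n⇒0<n∸m i<j)
             (ℕ.≤-trans (ℕ.m∸n≤m (toℕ j) (toℕ i)) (ℕ.≤-pred (Fin.toℕ<n j)))
             (fold-injective (toℕ i) (trans (sym (fold-+ a σ (toℕ i)))
               (trans (cong (fold a σ) (ℕ.m+[n∸m]≡n (ℕ.<⇒≤ i<j)))
                      (sym (Injection.injective (↔⇒↣ A↔Fin) eq)))))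
    where
    period : ∀ d → 0 < d → d ≤ r → fold a σ d ≡ a → fold a σ (r !) ≡ a
    period (suc d) _ d≤r eq with divides q r!≡ ← ∣-trans (m∣m*n {suc d} (d !)) (m≤n⇒m!∣n! d≤r) =
      trans (cong (fold a σ) r!≡) (fold-multiple {d = suc d} eq q)

-- The number whose base-B expansion consists of M digits 1.
repunit : ℕ → ℕ → ℕ
repunit B zero    = 0
repunit B (suc M) = repunit B M * B + 1

-- The geometric sum, written without subtraction: in base `suc b`, the number with all digits `b`
-- is the last position of a block of length `suc b ^ M`.
repunit-* : ∀ b M → b * repunit (suc b) M + 1 ≡ suc b ^ M
repunit-* b zero    = cong (_+ 1) (ℕ.*-zeroʳ b)
repunit-* b (suc M) = begin
  b * (R * suc b + 1) + 1   ≡⟨ identity b R ⟩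
  suc b * (b * R + 1)       ≡⟨ cong (suc b *_) (repunit-* b M) ⟩
  suc b * suc b ^ M         ∎
  where
  open ≡-Reasoning
  R = repunit (suc b) M
  open +-*-Solver
  identity : ∀ b R → b * (R * suc b + 1) + 1 ≡ suc b * (b * R + 1)
  identity = solve 2 (λ b R → b :* (R :* (con 1 :+ b) :+ con 1) :+ con 1
                           := (con 1 :+ b) :* (b :* R :+ con 1)) refl

applyUpTo-+ : ∀ {A : Set} (f : ℕ → A) m n →
              applyUpTo f (m + n) ≡ applyUpTo f m ++ applyUpTo (f ∘ (_+_ m)) n
applyUpTo-+ f zero    n = refl
applyUpTo-+ f (suc m) n = cong (f 0 ∷_) (applyUpTo-+ (f ∘ suc) m n)

applyUpTo-constant : ∀ {A : Set} {f : ℕ → A} {a} n →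
                     (∀ i → i < n → f i ≡ a) → applyUpTo f n ≡ replicate n a
applyUpTo-constant zero    eq = refl
applyUpTo-constant (suc n) eq =
  cong₂ _∷_ (eq 0 (s≤s z≤n)) (applyUpTo-constant n (λ i i<n → eq (suc i) (s≤s i<n)))

toList-applyUpTo : ∀ {A : Set} {n} (w : Vec A n) {f : ℕ → A} →
                   (∀ j → f (toℕ j) ≡ lookup w j) → toList w ≡ applyUpTo f n
toList-applyUpTo []      eq = refl
toList-applyUpTo (a ∷ w) eq =
  cong₂ _∷_ (sym (eq Fin.zero)) (toList-applyUpTo w (eq ∘ Fin.suc))

-- Blocks of a fixed point.

module FixedPoint {A : Set} {Q : ℕ} (2≤Q : 2 ≤ Q) (ϱ : Substitution A Q)
                  (v : ℤ → A) (fixed : IsFixedPoint ϱ v) where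

  private instance
    Q≢0 : NonZero Q
    Q≢0 = ℕ.>-nonZero (ℕ.≤-trans (s≤s z≤n) 2≤Q)

  Q^-nonZero : ∀ m → NonZero (Q ^ m)
  Q^-nonZero m = ℕ.m^n≢0 Q m

  -- The letter at position x < Qᵐ of ϱᵐ(c), obtained by applying to c the
  -- columns of ϱ given by the base-Q digits of x.
  letter : ℕ → ℕ → A → A
  letter zero    x c = c
  letter (suc m) x c = lookup (ϱ (letter m (x / Q) c)) (x mod Q)

  private
    nested-position : ∀ q N x y Q → q ℤ.* (Q ℤ.* N) ℤ.+ (y ℤ.+ x ℤ.* Q) ≡ (q ℤ.* N ℤ.+ x) ℤ.* Q ℤ.+ y
    nested-position = solve-∀

    nested : ∀ q N x y → q ℤ.* + (Q * N) ℤ.+ + (y + x * Q) ≡ (q ℤ.* + N ℤ.+ + x) ℤ.* + Q ℤ.+ + y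
    nested q N x y = trans
      (cong₂ (λ a b → q ℤ.* a ℤ.+ (+ y ℤ.+ b)) (ℤ.pos-* Q N) (ℤ.pos-* x Q))
      (nested-position q (+ N) (+ x) (+ y) (+ Q))

  -- The lowest base-Q digit of `x` is split off, so that `fixed` accounts for one application of ϱ
  -- and the quotient `x / Q` is a position in the block one level up.
  v-letter : ∀ m q x → x < Q ^ m → v (q ℤ.* + (Q ^ m) ℤ.+ + x) ≡ letter m x (v q)
  v-letter zero    q zero    _ = cong v (trans (ℤ.+-identityʳ _) (ℤ.*-identityʳ q))
  v-letter zero    q (suc x) (s≤s ())
  v-letter (suc m) q x x<Q^ = begin
    v (q ℤ.* + (Q * Q ^ m) ℤ.+ + x)
      ≡⟨ cong (λ x → v (q ℤ.* + (Q * Q ^ m) ℤ.+ + x)) x≡ ⟩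
    v (q ℤ.* + (Q * Q ^ m) ℤ.+ + (toℕ (x mod Q) + x / Q * Q))
      ≡⟨ cong v (nested q (Q ^ m) (x / Q) (toℕ (x mod Q))) ⟩
    v ((q ℤ.* + (Q ^ m) ℤ.+ + (x / Q)) ℤ.* + Q ℤ.+ + toℕ (x mod Q))
      ≡⟨ fixed (q ℤ.* + (Q ^ m) ℤ.+ + (x / Q)) (x mod Q) ⟩
    lookup (ϱ (v (q ℤ.* + (Q ^ m) ℤ.+ + (x / Q)))) (x mod Q)
      ≡⟨ cong (λ c → lookup (ϱ c) (x mod Q)) (v-letter m q (x / Q)
           (m<n*o⇒m/o<n (subst (x <_) (ℕ.*-comm Q (Q ^ m)) x<Q^))) ⟩
    letter (suc m) x (v q) ∎
    where
    open ≡-Reasoning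
    x≡ : x ≡ toℕ (x mod Q) + x / Q * Q
    x≡ = trans (m≡m%n+[m/n]*n x Q) (cong (_+ x / Q * Q) (sym (Fin.toℕ-fromℕ< (m%n<n x Q))))

  block : ∀ m t → ∃[ q ] ∃[ x ] (x < Q ^ m × t ≡ q ℤ.* + (Q ^ m) ℤ.+ + x)
  block m t = t ℤ./ℕ Q ^ m , t ℤ.%ℕ Q ^ m , n%ℕd<d t (Q ^ m) ,
    trans (a≡a%ℕn+[a/ℕn]*n t (Q ^ m)) (ℤ.+-comm (+ (t ℤ.%ℕ Q ^ m)) (t ℤ./ℕ Q ^ m ℤ.* + (Q ^ m)))
    where instance _ = Q^-nonZero m

  -- This links the words `power ϱ m`, in which primitivity and the language are expressed, with
  -- windows of `v`.
  power-applyUpTo : ∀ m q → power ϱ m (v q) ≡ applyUpTo (λ x → v (q ℤ.* + (Q ^ m) ℤ.+ + x)) (Q ^ m)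
  power-applyUpTo zero    q =
    cong (_∷ []) (cong v (sym (trans (ℤ.+-identityʳ _) (ℤ.*-identityʳ q))))
  power-applyUpTo (suc m) q = begin
    extend ϱ (power ϱ m (v q))
      ≡⟨ cong (extend ϱ) (power-applyUpTo m q) ⟩
    extend ϱ (applyUpTo (λ x → v (q ℤ.* + (Q ^ m) ℤ.+ + x)) (Q ^ m))
      ≡⟨ extend-applyUpTo (Q ^ m) (λ x j →
           trans (cong v (nested q (Q ^ m) x (toℕ j))) (fixed (q ℤ.* + (Q ^ m) ℤ.+ + x) j)) ⟩
    applyUpTo (λ x → v (q ℤ.* + (Q ^ suc m) ℤ.+ + x)) (Q ^ m * Q)
      ≡⟨ cong (applyUpTo _) (ℕ.*-comm (Q ^ m) Q) ⟩
    applyUpTo (λ x → v (q ℤ.* + (Q ^ suc m) ℤ.+ + x)) (Q ^ suc m) ∎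
    where
    open ≡-Reasoning
    extend-applyUpTo : ∀ {f g : ℕ → A} n → (∀ x j → g (toℕ j + x * Q) ≡ lookup (ϱ (f x)) j) →
                       extend ϱ (applyUpTo f n) ≡ applyUpTo g (n * Q)
    extend-applyUpTo zero _ = refl
    extend-applyUpTo {f} {g} (suc n) eq = trans
      (cong₂ _++_
        (toList-applyUpTo (ϱ (f 0)) (λ j → trans (cong g (sym (ℕ.+-identityʳ (toℕ j)))) (eq 0 j)))
        (extend-applyUpTo n λ x j → trans
          (cong g (trans (sym (ℕ.+-assoc Q (toℕ j) (x * Q)))
                    (trans (cong (_+ x * Q) (ℕ.+-comm Q (toℕ j))) (ℕ.+-assoc (toℕ j) Q (x * Q)))))
          (eq (suc x) j)))
      (sym (applyUpTo-+ g Q (n * Q)))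

  ∈-power⁻ : ∀ m q {b} → b ∈ power ϱ m (v q) → ∃[ x ] (x < Q ^ m × v (q ℤ.* + (Q ^ m) ℤ.+ + x) ≡ b)
  ∈-power⁻ m q b∈
    with x , x<Q^m , eq ← ∈-applyUpTo⁻ _ (subst (_ ∈_) (power-applyUpTo m q) b∈)
    = x , x<Q^m , sym eq

  -- Since p + l < Q^(p + l), the image of `v 0ℤ` under the power p + l of ϱ already covers the
  -- positions from 0 to p + l.
  inLanguage : ∀ p {a} l → (∀ j → j < l → v (+ (p + j)) ≡ a) → InLanguage ϱ (replicate l a)
  inLanguage p {a} l eq = v 0ℤ , p + l , subst (Infix _≡_ (replicate l a)) (sym word)
    (fromView (MkView (applyUpTo f p) (Pointwise.refl refl) _))
    where
    open ≡-Reasoning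
    D = Q ^ (p + l)
    rest = D ∸ (p + l)
    f : ℕ → A
    f x = v (0ℤ ℤ.* + D ℤ.+ + x)
    f≡ : ∀ x → f x ≡ v (+ x)
    f≡ x = cong v (trans (cong (ℤ._+ + x) (ℤ.*-zeroˡ (+ D))) (ℤ.+-identityˡ (+ x)))
    word : power ϱ (p + l) (v 0ℤ) ≡
           applyUpTo f p ++ replicate l a ++ applyUpTo (f ∘ (_+_ p) ∘ (_+_ l)) rest
    word = begin
      power ϱ (p + l) (v 0ℤ)
        ≡⟨ power-applyUpTo (p + l) 0ℤ ⟩
      applyUpTo f D
        ≡⟨ cong (applyUpTo f) (trans (sym (ℕ.m+[n∸m]≡n (ℕ.<⇒≤ (n<m^n 2≤Q (p + l))))) (ℕ.+-assoc p l rest)) ⟩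
      applyUpTo f (p + (l + rest))
        ≡⟨ applyUpTo-+ f p (l + rest) ⟩
      applyUpTo f p ++ applyUpTo (f ∘ (_+_ p)) (l + rest)
        ≡⟨ cong (applyUpTo f p ++_) (applyUpTo-+ (f ∘ (_+_ p)) l rest) ⟩
      applyUpTo f p ++ applyUpTo (f ∘ (_+_ p)) l ++ applyUpTo (f ∘ (_+_ p) ∘ (_+_ l)) rest
        ≡⟨ cong (λ w → applyUpTo f p ++ w ++ applyUpTo (f ∘ (_+_ p) ∘ (_+_ l)) rest)
             (applyUpTo-constant l λ j j<l → trans (f≡ (p + j)) (eq j j<l)) ⟩
      applyUpTo f p ++ replicate l a ++ applyUpTo (f ∘ (_+_ p) ∘ (_+_ l)) rest ∎

  module Columns (bijective : IsBijective ϱ) where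

    letter-injective : ∀ m x → Injective _≡_ _≡_ (letter m x)
    letter-injective zero    x eq = eq
    letter-injective (suc m) x eq = letter-injective m (x / Q) (proj₁ (bijective (x mod Q)) eq)

    private
      v-start : ∀ {a L} d t → (∀ i → i < L → v (t ℤ.+ + i ℤ.* d) ≡ a) → 0 < L → v t ≡ a
      v-start d t eq 0<L =
        trans (cong v (sym (trans (cong (ℤ._+_ t) (ℤ.*-zeroˡ d)) (ℤ.+-identityʳ t)))) (eq 0 0<L)

    -- All terms have the same residue `x` modulo Qˢ, so they arise from consecutive terms with
    -- difference `d` through the single column `letter s x`, which is injective.
    desubstitute : ∀ s {a} d L → HasProgression v a (+ (Q ^ s) ℤ.* d) L →
                   ∃[ b ] HasProgression v b d L
    desubstitute s {a} d L (t , eq) with q , x , x<Q^s , t≡ ← block s t =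
      v q , q , λ i i<L → letter-injective s x (begin
        letter s x (v (q ℤ.+ + i ℤ.* d))
          ≡⟨ v-letter s (q ℤ.+ + i ℤ.* d) x x<Q^s ⟨
        v ((q ℤ.+ + i ℤ.* d) ℤ.* + (Q ^ s) ℤ.+ + x)
          ≡⟨ cong v (rearrange q (+ i) d (+ (Q ^ s)) (+ x)) ⟩
        v ((q ℤ.* + (Q ^ s) ℤ.+ + x) ℤ.+ + i ℤ.* (+ (Q ^ s) ℤ.* d))
          ≡⟨ cong (λ t → v (t ℤ.+ + i ℤ.* (+ (Q ^ s) ℤ.* d))) t≡ ⟨
        v (t ℤ.+ + i ℤ.* (+ (Q ^ s) ℤ.* d))
          ≡⟨ eq i i<L ⟩
        a
          ≡⟨ v-start (+ (Q ^ s) ℤ.* d) t eq (ℕ.≤-<-trans z≤n i<L) ⟨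
        v t
          ≡⟨ cong v t≡ ⟩
        v (q ℤ.* + (Q ^ s) ℤ.+ + x)
          ≡⟨ v-letter s q x x<Q^s ⟩
        letter s x (v q) ∎)
      where
      open ≡-Reasoning
      rearrange : ∀ q i d D x → (q ℤ.+ i ℤ.* d) ℤ.* D ℤ.+ x ≡ (q ℤ.* D ℤ.+ x) ℤ.+ i ℤ.* (D ℤ.* d)
      rearrange = solve-∀

    -- If `b` stands at position `x` of ϱᵐ(a), it stands at position `x` of the block of every term
    -- of the given progression.
    substitute : ∀ m {a b} d L → 0 < L → b ∈ power ϱ m a → HasProgression v a d L →
                 HasProgression v b (+ (Q ^ m) ℤ.* d) L
    substitute m {a} {b} d L 0<L b∈ (t , eq)
      with x , x<Q^m , at ← ∈-power⁻ m t (subst (λ c → b ∈ power ϱ m c) (sym (v-start d t eq 0<L)) b∈)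
      = t ℤ.* + (Q ^ m) ℤ.+ + x , λ i i<L → begin
        v ((t ℤ.* D ℤ.+ + x) ℤ.+ + i ℤ.* (D ℤ.* d)) ≡⟨ cong v (rearrange t (+ i) d D (+ x)) ⟩
        v ((t ℤ.+ + i ℤ.* d) ℤ.* D ℤ.+ + x)         ≡⟨ v-letter m _ x x<Q^m ⟩
        letter m x (v (t ℤ.+ + i ℤ.* d))            ≡⟨ cong (letter m x) (trans (eq i i<L) (sym v-t)) ⟩
        letter m x (v t)                            ≡⟨ v-letter m t x x<Q^m ⟨
        v (t ℤ.* D ℤ.+ + x)                         ≡⟨ at ⟩
        b ∎
      where
      open ≡-Reasoning
      D = + (Q ^ m)
      v-t = v-start d t eq 0<L
      rearrange : ∀ q i d D x → (q ℤ.* D ℤ.+ x) ℤ.+ i ℤ.* (D ℤ.* d) ≡ (q ℤ.+ i ℤ.* d) ℤ.* D ℤ.+ x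
      rearrange = solve-∀

    -- Identity columns and the resulting progressions.

    module Finite {r : ℕ} (A↔Fin : A ↔ Fin r) (k : ℕ) where

      base difference blockLength : ℕ
      base        = Q ^ k
      difference  = repunit base (r !)
      blockLength = base ^ (r !)

      -- The position has r! digits i in base Qᵏ below those of q, and the
      -- column of ϱᵏ at i, being a permutation of r letters, has order dividing r!.
      v-repdigit : ∀ q i → i < base → v (q ℤ.* + blockLength ℤ.+ + (i * difference)) ≡ v q
      v-repdigit q i i<B = trans (digits (r !)) (fold-factorial (letter-injective k i) A↔Fin (v q))
        where
        rearrange : ∀ q B P i R → q ℤ.* (B ℤ.* P) ℤ.+ i ℤ.* (R ℤ.* B ℤ.+ 1ℤ) ≡
                                  (q ℤ.* P ℤ.+ i ℤ.* R) ℤ.* B ℤ.+ i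
        rearrange = solve-∀
        position : ∀ M → q ℤ.* + (base ^ suc M) ℤ.+ + (i * repunit base (suc M)) ≡
                         (q ℤ.* + (base ^ M) ℤ.+ + (i * repunit base M)) ℤ.* + base ℤ.+ + i
        position M = begin
          q ℤ.* + (base * base ^ M) ℤ.+ + (i * (R * base + 1))
            ≡⟨ cong₂ (λ x y → q ℤ.* x ℤ.+ y) (ℤ.pos-* base (base ^ M)) (ℤ.pos-* i (R * base + 1)) ⟩
          q ℤ.* (+ base ℤ.* + (base ^ M)) ℤ.+ + i ℤ.* (+ (R * base) ℤ.+ 1ℤ)
            ≡⟨ cong (λ x → q ℤ.* (+ base ℤ.* + (base ^ M)) ℤ.+ + i ℤ.* (x ℤ.+ 1ℤ)) (ℤ.pos-* R base) ⟩
          q ℤ.* (+ base ℤ.* + (base ^ M)) ℤ.+ + i ℤ.* (+ R ℤ.* + base ℤ.+ 1ℤ)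
            ≡⟨ rearrange q (+ base) (+ (base ^ M)) (+ i) (+ R) ⟩
          (q ℤ.* + (base ^ M) ℤ.+ + i ℤ.* + R) ℤ.* + base ℤ.+ + i
            ≡⟨ cong (λ x → (q ℤ.* + (base ^ M) ℤ.+ x) ℤ.* + base ℤ.+ + i) (ℤ.pos-* i R) ⟨
          (q ℤ.* + (base ^ M) ℤ.+ + (i * R)) ℤ.* + base ℤ.+ + i ∎
          where
          open ≡-Reasoning
          R = repunit base M
        digits : ∀ M → v (q ℤ.* + (base ^ M) ℤ.+ + (i * repunit base M)) ≡ fold (v q) (letter k i) M
        digits zero    = cong v (trans (cong (λ x → q ℤ.* 1ℤ ℤ.+ + x) (ℕ.*-zeroʳ i))
                           (trans (ℤ.+-identityʳ (q ℤ.* 1ℤ)) (ℤ.*-identityʳ q)))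
        digits (suc M) = trans (cong v (position M))
          (trans (v-letter k (q ℤ.* + (base ^ M) ℤ.+ + (i * repunit base M)) i i<B)
                 (cong (letter k i) (digits M)))

      v-progression : ∀ q j → j ≤ k → v (q ℤ.* + blockLength ℤ.+ + (j * difference)) ≡ v q
      -- Every `j ≤ k` is a single digit in base Qᵏ, because k < Qᵏ.
      v-progression q j j≤k = v-repdigit q j (ℕ.≤-<-trans j≤k (n<m^n 2≤Q k))

      difference-pos : 0 < difference
      difference-pos with r ! | ℕ.1≤n! r
      ... | suc M | _ = ℕ.m≤n+m 1 (repunit base M * base)

      -- The repunit is one more than a multiple of `base`, and `base` is a multiple of Q because k
      -- is positive, so a common divisor divides 1.
      difference-coprime : 1 ≤ k → Coprime difference Q
      difference-coprime (s≤s {n = k′} z≤n) {i} (i∣difference , i∣Q) with r ! | ℕ.1≤n! r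
      ... | suc M | _ = ∣1⇒≡1 (∣m+n∣m⇒∣n i∣difference
        (∣n⇒∣m*n (repunit base M) (∣m⇒∣m*n (Q ^ k′) i∣Q)))

      private
        depth = k * r !

        blockLength≡ : Q ^ depth ≡ blockLength
        blockLength≡ = sym (ℕ.^-*-assoc Q k (r !))

        v-first : ∀ q → v (q ℤ.* + (Q ^ depth)) ≡ v q
        v-first q = trans (cong v (trans (cong (λ N → q ℤ.* + N) blockLength≡) (sym (ℤ.+-identityʳ _))))
                          (v-progression q 0 z≤n)

        -- The last position of a block has all digits equal to `base` minus one, so its column is
        -- again an identity column by `v-repdigit`.
        v-last : ∀ q → v (q ℤ.* + (Q ^ depth) ℤ.- 1ℤ) ≡ v (q ℤ.- 1ℤ)
        v-last q = trans (cong v position) (v-repdigit (q ℤ.- 1ℤ) b b<base)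
          where
          b = ℕ.pred base
          base≡ : suc b ≡ base
          base≡ = ℕ.suc-pred base {{Q^-nonZero k}}
          b<base : b < base
          b<base = ℕ.≤-reflexive base≡
          length≡ : b * difference + 1 ≡ blockLength
          length≡ = subst (λ B → b * repunit B (r !) + 1 ≡ B ^ (r !)) base≡ (repunit-* b (r !))
          rearrange : ∀ q x → q ℤ.* (x ℤ.+ 1ℤ) ℤ.- 1ℤ ≡ (q ℤ.- 1ℤ) ℤ.* (x ℤ.+ 1ℤ) ℤ.+ x
          rearrange = solve-∀
          position : q ℤ.* + (Q ^ depth) ℤ.- 1ℤ ≡ (q ℤ.- 1ℤ) ℤ.* + blockLength ℤ.+ + (b * difference)
          position = begin
            q ℤ.* + (Q ^ depth) ℤ.- 1ℤ
              ≡⟨ cong (λ N → q ℤ.* + N ℤ.- 1ℤ) (trans blockLength≡ (sym length≡)) ⟩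
            q ℤ.* (+ (b * difference) ℤ.+ 1ℤ) ℤ.- 1ℤ
              ≡⟨ rearrange q (+ (b * difference)) ⟩
            (q ℤ.- 1ℤ) ℤ.* + (b * difference + 1) ℤ.+ + (b * difference)
              ≡⟨ cong (λ N → (q ℤ.- 1ℤ) ℤ.* + N ℤ.+ + (b * difference)) length≡ ⟩
            (q ℤ.- 1ℤ) ℤ.* + blockLength ℤ.+ + (b * difference) ∎
            where open ≡-Reasoning

      -- Effective uniform recurrence and decidability of progressions.

      module Recurrence (1≤k : 1 ≤ k) (prim : IsPrimitive ϱ) where

        letterBound : ℕ
        letterBound = Q ^ proj₁ prim

        letter-occurs : ∀ a → ∃[ x ] (x < letterBound × v (+ x) ≡ a)
        letter-occurs a
          with x , x<L , eq ← ∈-power⁻ (proj₁ prim) 0ℤ (proj₂ (proj₂ prim) (v 0ℤ) a)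
          = x , x<L , trans (cong v (sym (trans (cong (ℤ._+ + x) (ℤ.*-zeroˡ (+ letterBound)))
                                                (ℤ.+-identityˡ (+ x))))) eq

        SamePair : ℤ → ℤ → Set
        SamePair y z = v y ≡ v z × v (y ℤ.- 1ℤ) ≡ v (z ℤ.- 1ℤ)

        pairBound : ℕ
        pairBound = letterBound * Q ^ depth

        -- With E = depth, a pair inside a block ϱᴱ(c) recurs in every block ϱᴱ(c), and a
        -- pair straddling the block boundary at qQᴱ equals the one at q, since the first
        -- and last columns of ϱᴱ are the identity.
        recurrent-pair : ∀ z → ∃[ w ] (w < pairBound × SamePair (+ w) z)
        recurrent-pair z = descend ∣ z ∣ z ℕ.≤-refl
          where
          depth-pos : 1 ≤ depth
          depth-pos = ℕ.*-mono-≤ 1≤k (ℕ.1≤n! r)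
          N = Q ^ depth
          2≤N : 2 ≤ N
          2≤N = ℕ.≤-trans (s≤s depth-pos) (n<m^n 2≤Q depth)
          pairBound-pos : 0 < pairBound
          pairBound-pos = ℕ.*-mono-≤ (ℕ.≤-trans (s≤s z≤n) (n<m^n 2≤Q (proj₁ prim)))
                                     (ℕ.≤-trans (s≤s z≤n) 2≤N)
          -- As N is at least 2, passing from `q * N` to `q` decreases a nonzero absolute value, so
          -- the descent through block boundaries ends at 0.
          shorter : ∀ f q → ∣ q ℤ.* + N ∣ ≤ suc f → ∣ q ∣ ≤ f
          shorter f q ∣qN∣≤ with ∣ q ∣ | subst (_≤ suc f) (ℤ.∣i*j∣≡∣i∣*∣j∣ q (+ N)) ∣qN∣≤
          ... | zero  | _   = z≤n
          ... | suc n | le  = ℕ.≤-pred (ℕ.≤-trans (s≤s (s≤s (ℕ.m≤m+n n n)))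
                (ℕ.≤-trans (ℕ.≤-reflexive double) (ℕ.≤-trans (ℕ.*-monoʳ-≤ (suc n) 2≤N) le)))
            where
            double : suc (suc (n + n)) ≡ suc n * 2
            double = trans (cong suc (sym (ℕ.+-suc n n)))
              (trans (cong (_+_ (suc n)) (sym (ℕ.+-identityʳ (suc n)))) (ℕ.*-comm 2 (suc n)))
          predecessor : ∀ y x → (y ℤ.+ (1ℤ ℤ.+ x)) ℤ.- 1ℤ ≡ y ℤ.+ x
          predecessor = solve-∀
          descend : ∀ f z → ∣ z ∣ ≤ f → ∃[ w ] (w < pairBound × SamePair (+ w) z)
          descend zero    z ∣z∣≤0 with refl ← ℤ.∣i∣≡0⇒i≡0 {z} (ℕ.n≤0⇒n≡0 ∣z∣≤0) =
            0 , pairBound-pos , refl , refl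
          descend (suc f) z ∣z∣≤ with block depth z
          ... | q , zero , _ , z≡
            with z≡qN ← trans z≡ (ℤ.+-identityʳ (q ℤ.* + N))
            with w , w< , same , same-1 ← descend f q (shorter f q (subst (λ z → ∣ z ∣ ≤ suc f) z≡qN ∣z∣≤))
            = w , w< , trans same (sym (trans (cong v z≡qN) (v-first q)))
                     , trans same-1 (sym (trans (cong (λ z → v (z ℤ.- 1ℤ)) z≡qN) (v-last q)))
          ... | q , suc x , x<N , z≡ with y , y< , vy≡ ← letter-occurs (v q)
            = y * N + suc x
            , ℕ.<-≤-trans (ℕ.+-monoʳ-< (y * N) x<N)
                (ℕ.≤-trans (ℕ.≤-reflexive (ℕ.+-comm (y * N) N)) (ℕ.*-monoˡ-≤ N y<))
            , trans (at-block (suc x) x<N) (cong v (sym z≡))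
            , (begin
                v (+ (y * N + suc x) ℤ.- 1ℤ)          ≡⟨ cong v (predecessor (+ (y * N)) (+ x)) ⟩
                v (+ (y * N + x))                     ≡⟨ at-block x (ℕ.<⇒≤ x<N) ⟩
                v (q ℤ.* + N ℤ.+ + x)                 ≡⟨ cong v (predecessor (q ℤ.* + N) (+ x)) ⟨
                v ((q ℤ.* + N ℤ.+ + suc x) ℤ.- 1ℤ)    ≡⟨ cong (λ z → v (z ℤ.- 1ℤ)) z≡ ⟨
                v (z ℤ.- 1ℤ) ∎)
            where
            open ≡-Reasoning
            at-block : ∀ x → x < N → v (+ (y * N + x)) ≡ v (q ℤ.* + N ℤ.+ + x)
            at-block x x<N = begin
              v (+ (y * N) ℤ.+ + x)        ≡⟨ cong (λ n → v (n ℤ.+ + x)) (ℤ.pos-* y N) ⟩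
              v (+ y ℤ.* + N ℤ.+ + x)      ≡⟨ v-letter depth (+ y) x x<N ⟩
              letter depth x (v (+ y))     ≡⟨ cong (letter depth x) vy≡ ⟩
              letter depth x (v q)         ≡⟨ v-letter depth q x x<N ⟨
              v (q ℤ.* + N ℤ.+ + x)        ∎

        -- Since l < Qˡ, a window of l + 1 letters meets at most two adjacent blocks of length Qˡ,
        -- hence is determined by a pair of neighbouring letters and an offset; `recurrent-pair`
        -- bounds where the pair recurs. As a pair is indexed by its right member, the window may
        -- start in block -1, which explains the subtracted Qˡ.
        uniformly-recurrent : ∀ l → ∃[ R ] (∀ t → ∃[ w ] (w < R ×
          (∀ y → y ≤ l → v (+ w ℤ.- + (Q ^ l) ℤ.+ + y) ≡ v (t ℤ.+ + y))))
        uniformly-recurrent l = pairBound * D , λ t →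
          let q , x , x<D , t≡ = block l t
              w , w< , same    = recurrent-pair (q ℤ.+ 1ℤ)
          in w * D + x
           , ℕ.<-≤-trans (ℕ.+-monoʳ-< (w * D) x<D)
               (ℕ.≤-trans (ℕ.≤-reflexive (ℕ.+-comm (w * D) D)) (ℕ.*-monoˡ-≤ D w<))
           , λ y y≤l → begin
               v (+ (w * D + x) ℤ.- + D ℤ.+ + y)
                 ≡⟨ cong (λ n → v (n ℤ.+ + x ℤ.- + D ℤ.+ + y)) (ℤ.pos-* w D) ⟩
               v (+ w ℤ.* + D ℤ.+ + x ℤ.- + D ℤ.+ + y)
                 ≡⟨ cong v (left (+ w) (+ D) (+ x) (+ y)) ⟩
               v ((+ w ℤ.- 1ℤ) ℤ.* + D ℤ.+ + (x + y))
                 ≡⟨ two-blocks same (x + y) (ℕ.+-mono-< x<D (ℕ.≤-<-trans y≤l (n<m^n 2≤Q l))) ⟩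
               v ((q ℤ.+ 1ℤ ℤ.- 1ℤ) ℤ.* + D ℤ.+ + (x + y))
                 ≡⟨ cong v (right q (+ D) (+ x) (+ y)) ⟩
               v (q ℤ.* + D ℤ.+ + x ℤ.+ + y)
                 ≡⟨ cong (λ t → v (t ℤ.+ + y)) t≡ ⟨
               v (t ℤ.+ + y) ∎
          where
          open ≡-Reasoning
          D = Q ^ l
          left : ∀ w D x y → w ℤ.* D ℤ.+ x ℤ.- D ℤ.+ y ≡ (w ℤ.- 1ℤ) ℤ.* D ℤ.+ (x ℤ.+ y)
          left = solve-∀
          right : ∀ q D x y → (q ℤ.+ 1ℤ ℤ.- 1ℤ) ℤ.* D ℤ.+ (x ℤ.+ y) ≡ q ℤ.* D ℤ.+ x ℤ.+ y
          right = solve-∀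
          next : ∀ z D u → (z ℤ.- 1ℤ) ℤ.* D ℤ.+ (D ℤ.+ u) ≡ z ℤ.* D ℤ.+ u
          next = solve-∀
          two-blocks : ∀ {y z} → SamePair y z → ∀ u → u < D + D →
                       v ((y ℤ.- 1ℤ) ℤ.* + D ℤ.+ + u) ≡ v ((z ℤ.- 1ℤ) ℤ.* + D ℤ.+ + u)
          two-blocks {y} {z} (same , same-1) u u< with u ℕ.<? D
          ... | yes u<D = trans (v-letter l (y ℤ.- 1ℤ) u u<D)
                (trans (cong (letter l u) same-1) (sym (v-letter l (z ℤ.- 1ℤ) u u<D)))
          ... | no  u≮D with D≤u ← ℕ.≮⇒≥ u≮D = begin
                v ((y ℤ.- 1ℤ) ℤ.* + D ℤ.+ + u)     ≡⟨ reduce y ⟩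
                v (y ℤ.* + D ℤ.+ + (u ∸ D))        ≡⟨ v-letter l y (u ∸ D) u∸D<D ⟩
                letter l (u ∸ D) (v y)             ≡⟨ cong (letter l (u ∸ D)) same ⟩
                letter l (u ∸ D) (v z)             ≡⟨ v-letter l z (u ∸ D) u∸D<D ⟨
                v (z ℤ.* + D ℤ.+ + (u ∸ D))        ≡⟨ reduce z ⟨
                v ((z ℤ.- 1ℤ) ℤ.* + D ℤ.+ + u) ∎
            where
            reduce : ∀ z → v ((z ℤ.- 1ℤ) ℤ.* + D ℤ.+ + u) ≡ v (z ℤ.* + D ℤ.+ + (u ∸ D))
            reduce z = cong v (trans
              (cong (λ u → (z ℤ.- 1ℤ) ℤ.* + D ℤ.+ + u) (sym (ℕ.m+[n∸m]≡n D≤u)))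
              (next z (+ D) (+ (u ∸ D))))
            u∸D<D : u ∸ D < D
            u∸D<D = ℕ.+-cancelˡ-< D (u ∸ D) D (subst (_< D + D) (sym (ℕ.m+[n∸m]≡n D≤u)) u<)

        -- Any progression lies in a window that recurs at one of the `R` starts given by
        -- `uniformly-recurrent`, so only these need to be searched.
        progression? : ∀ a n L → Dec (HasProgression v a (+ n) L)
        progression? a n L with R , recurs ← uniformly-recurrent (L * n)
          with ℕ.anyUpTo? (λ w → ℕ.allUpTo?
                 (λ i → v (+ w ℤ.- + (Q ^ (L * n)) ℤ.+ + i ℤ.* + n) ≟ a) L) R
          where
          _≟_ : DecidableEquality A
          _≟_ = via-injection (↔⇒↣ A↔Fin) Fin._≟_
        ... | yes (w , _ , eq) = yes (+ w ℤ.- + (Q ^ (L * n)) , λ i i<L → eq i<L)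
        ... | no  none = no λ (t , eq) →
          let w , w<R , same = recurs t
          in none (w , w<R , λ {i} i<L → trans
               (cong (λ x → v (+ w ℤ.- + (Q ^ (L * n)) ℤ.+ x)) (sym (ℤ.pos-* i n)))
               (trans (same (i * n) (ℕ.*-monoˡ-≤ n (ℕ.<⇒≤ i<L)))
                 (trans (cong (λ x → v (t ℤ.+ x)) (ℤ.pos-* i n)) (eq i i<L))))

-- Long progressions

inverse-modulo : ∀ {n Q} → Coprime n Q → ∃[ c ] ∃[ e ] c ℤ.* + n ≡ 1ℤ ℤ.+ e ℤ.* + Q
inverse-modulo {n} {Q} coprime with coprime-Bézout coprime
... | Bézout.+- x y eq = + x , + y ,
  trans (sym (ℤ.pos-* x n)) (trans (cong +_ (sym eq)) (cong (ℤ._+_ 1ℤ) (ℤ.pos-* y Q)))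
... | Bézout.-+ x y eq = ℤ.- + x , ℤ.- + y , (begin
  ℤ.- + x ℤ.* + n                  ≡⟨ negate (+ x) (+ n) ⟩
  1ℤ ℤ.+ ℤ.- (1ℤ ℤ.+ + x ℤ.* + n)  ≡⟨ cong (λ z → 1ℤ ℤ.+ ℤ.- (1ℤ ℤ.+ z)) (ℤ.pos-* x n) ⟨
  1ℤ ℤ.+ ℤ.- + (1 + x * n)         ≡⟨ cong (λ z → 1ℤ ℤ.+ ℤ.- + z) eq ⟩
  1ℤ ℤ.+ ℤ.- + (y * Q)             ≡⟨ cong (λ z → 1ℤ ℤ.+ ℤ.- z) (ℤ.pos-* y Q) ⟩
  1ℤ ℤ.+ ℤ.- (+ y ℤ.* + Q)         ≡⟨ cong (ℤ._+_ 1ℤ) (ℤ.neg-distribˡ-* (+ y) (+ Q)) ⟩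
  1ℤ ℤ.+ ℤ.- + y ℤ.* + Q ∎)
  where
  open ≡-Reasoning
  negate : ∀ x n → ℤ.- x ℤ.* n ≡ 1ℤ ℤ.+ ℤ.- (1ℤ ℤ.+ x ℤ.* n)
  negate = solve-∀

-- From inverses modulo Q and modulo Qᵐ, the errors `c * n - 1` and `c′ * n - 1` are multiplied: the
-- product is divisible by Q^(m + 1) and has the form 1 minus a multiple of `n`.
inverse-modulo-power : ∀ {n Q} → Coprime n Q → ∀ m →
                       ∃[ c ] ∃[ e ] c ℤ.* + n ≡ 1ℤ ℤ.+ e ℤ.* + (Q ^ m)
inverse-modulo-power {n} {Q} coprime zero = 0ℤ , ℤ.- 1ℤ , ℤ.*-zeroˡ (+ n)
inverse-modulo-power {n} {Q} coprime (suc m)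
  with c , e , eq ← inverse-modulo coprime | c′ , e′ , eq′ ← inverse-modulo-power coprime m
  = c ℤ.+ c′ ℤ.- + n ℤ.* c ℤ.* c′ , ℤ.- (e ℤ.* e′) , (begin
    (c ℤ.+ c′ ℤ.- + n ℤ.* c ℤ.* c′) ℤ.* + n
      ≡⟨ factor (+ n) c c′ ⟩
    1ℤ ℤ.- (c ℤ.* + n ℤ.- 1ℤ) ℤ.* (c′ ℤ.* + n ℤ.- 1ℤ)
      ≡⟨ cong₂ (λ x y → 1ℤ ℤ.- (x ℤ.- 1ℤ) ℤ.* (y ℤ.- 1ℤ)) eq eq′ ⟩
    1ℤ ℤ.- (1ℤ ℤ.+ e ℤ.* + Q ℤ.- 1ℤ) ℤ.* (1ℤ ℤ.+ e′ ℤ.* + (Q ^ m) ℤ.- 1ℤ)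
      ≡⟨ expand e e′ (+ Q) (+ (Q ^ m)) ⟩
    1ℤ ℤ.+ ℤ.- (e ℤ.* e′) ℤ.* (+ Q ℤ.* + (Q ^ m))
      ≡⟨ cong (λ x → 1ℤ ℤ.+ ℤ.- (e ℤ.* e′) ℤ.* x) (ℤ.pos-* Q (Q ^ m)) ⟨
    1ℤ ℤ.+ ℤ.- (e ℤ.* e′) ℤ.* + (Q ^ suc m) ∎)
  where
  open ≡-Reasoning
  factor : ∀ n c c′ → (c ℤ.+ c′ ℤ.- n ℤ.* c ℤ.* c′) ℤ.* n ≡
                      1ℤ ℤ.- (c ℤ.* n ℤ.- 1ℤ) ℤ.* (c′ ℤ.* n ℤ.- 1ℤ)
  factor = solve-∀
  expand : ∀ e e′ Q D → 1ℤ ℤ.- (1ℤ ℤ.+ e ℤ.* Q ℤ.- 1ℤ) ℤ.* (1ℤ ℤ.+ e′ ℤ.* D ℤ.- 1ℤ) ≡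
                        1ℤ ℤ.+ ℤ.- (e ℤ.* e′) ℤ.* (Q ℤ.* D)
  expand = solve-∀

module _ {A : Set} (v : ℤ → A) (repetitive : IsRepetitive v) where

  -- Recurrence to the right of 0 provides a start that is a natural number, as needed for positions
  -- inside the blocks ϱᵐ(v 0).
  progression-from-ℕ : ∀ {a} n L → HasProgression v a (+ n) L →
                       ∃[ t ] (∀ i → i < L → v (+ (t + i * n)) ≡ a)
  progression-from-ℕ n L (t , eq) with repetitive t (suc (L * n))
  ... | R , recurs with recurs 0ℤ
  ... | + p , _ , _ , same = p , λ i i<L →
    trans (same (i * n) (s≤s (ℕ.*-monoˡ-≤ n (ℕ.<⇒≤ i<L))))
      (trans (cong (λ x → v (t ℤ.+ x)) (ℤ.pos-* i n)) (eq i i<L))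

  module _ {Q : ℕ} (2≤Q : 2 ≤ Q) (ϱ : Substitution A Q) (fixed : IsFixedPoint ϱ v)
           (bijective : IsBijective ϱ) {k : ℕ}
           (no-power : ∀ a → ¬ InLanguage ϱ (replicate (suc k) a)) where

    open FixedPoint 2≤Q ϱ v fixed
    open Columns bijective

    -- A run is a progression with difference 1; moved to a non-negative start, it becomes a
    -- forbidden word of the language.
    no-run : ∀ {a} q → ¬ (∀ j → j ≤ k → v (q ℤ.+ + j) ≡ a)
    no-run {a} q run with p , eq ← progression-from-ℕ 1 (suc k)
        (q , λ i i≤k → trans (cong (λ x → v (q ℤ.+ x)) (ℤ.*-identityʳ (+ i))) (run i (ℕ.≤-pred i≤k)))
      = no-power a (inLanguage p (suc k) λ j j<L →
          trans (cong (λ x → v (+ (p + x))) (sym (ℕ.*-identityʳ j))) (eq j j<L))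

    -- As d is invertible modulo Qᵐ, one of the first Qᵐ terms of a progression
    -- is congruent to y modulo Qᵐ. The k + 1 terms from there on lie in
    -- consecutive blocks, at the positions x j, where the block ϱᵐ(v 0) also has
    -- the letter a; hence these blocks all come from the letter v 0.
    no-long-progression : ∀ m {a} d δ c e → d ≡ + (Q ^ m) ℤ.+ δ →
      c ℤ.* d ≡ 1ℤ ℤ.+ e ℤ.* + (Q ^ m) → (x : ℕ → ℕ) (y : ℤ) →
      (∀ j → j ≤ k → x j < Q ^ m × + x j ≡ y ℤ.+ + j ℤ.* δ × v (+ x j) ≡ a) →
      ¬ HasProgression v a d (Q ^ m + k)
    no-long-progression m {a} d δ c e d≡ inverse x y occurs (t , eq) =
      no-run q λ j j≤k → let xj< , xj≡ , vxj = occurs j j≤k in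
        letter-injective m (x j) (begin
          letter m (x j) (v (q ℤ.+ + j))      ≡⟨ v-letter m (q ℤ.+ + j) (x j) xj< ⟨
          v ((q ℤ.+ + j) ℤ.* D ℤ.+ + x j)     ≡⟨ cong v (position j xj≡) ⟩
          v (t ℤ.+ + (i + j) ℤ.* d)           ≡⟨ eq (i + j) (ℕ.+-mono-<-≤ i<D j≤k) ⟩
          a                                   ≡⟨ vxj ⟨
          v (+ x j)                           ≡⟨ cong v (origin (+ x j) D) ⟩
          v (0ℤ ℤ.* D ℤ.+ + x j)              ≡⟨ v-letter m 0ℤ (x j) xj< ⟩
          letter m (x j) (v 0ℤ) ∎)
      where
      open ≡-Reasoning
      instance _ = Q^-nonZero m
      D = + (Q ^ m)
      -- As `c` inverts `d` modulo Qᵐ, the residue `i` of `w` solves t + i d ≡ y. Since i < Qᵐ and j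
      -- ≤ k, the index i + j stays below the length Qᵐ + k.
      w = (y ℤ.- t) ℤ.* c
      i = w ℤ.%ℕ Q ^ m
      f = w ℤ./ℕ Q ^ m
      i<D : i < Q ^ m
      i<D = n%ℕd<d w (Q ^ m)
      -- The exact quotient in this congruence: t + i d = q Qᵐ + y.
      q = (y ℤ.- t) ℤ.* e ℤ.- f ℤ.* d
      origin : ∀ x D → x ≡ 0ℤ ℤ.* D ℤ.+ x
      origin = solve-∀
      i≡ : + i ≡ w ℤ.- f ℤ.* D
      i≡ = trans (subtract (+ i) (f ℤ.* D)) (cong (ℤ._- f ℤ.* D) (sym (a≡a%ℕn+[a/ℕn]*n w (Q ^ m))))
        where
        subtract : ∀ i g → i ≡ i ℤ.+ g ℤ.- g
        subtract = solve-∀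
      first : ∀ t y e f d D → t ℤ.+ ((y ℤ.- t) ℤ.* (1ℤ ℤ.+ e ℤ.* D) ℤ.- f ℤ.* D ℤ.* d) ≡
                              ((y ℤ.- t) ℤ.* e ℤ.- f ℤ.* d) ℤ.* D ℤ.+ y
      first = solve-∀
      distribute : ∀ t s c f D d → t ℤ.+ (s ℤ.* c ℤ.- f ℤ.* D) ℤ.* d ≡
                                   t ℤ.+ (s ℤ.* (c ℤ.* d) ℤ.- f ℤ.* D ℤ.* d)
      distribute = solve-∀
      start : t ℤ.+ + i ℤ.* d ≡ q ℤ.* D ℤ.+ y
      start = begin
        t ℤ.+ + i ℤ.* d
          ≡⟨ cong (λ i → t ℤ.+ i ℤ.* d) i≡ ⟩
        t ℤ.+ ((y ℤ.- t) ℤ.* c ℤ.- f ℤ.* D) ℤ.* d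
          ≡⟨ distribute t (y ℤ.- t) c f D d ⟩
        t ℤ.+ ((y ℤ.- t) ℤ.* (c ℤ.* d) ℤ.- f ℤ.* D ℤ.* d)
          ≡⟨ cong (λ z → t ℤ.+ ((y ℤ.- t) ℤ.* z ℤ.- f ℤ.* D ℤ.* d)) inverse ⟩
        t ℤ.+ ((y ℤ.- t) ℤ.* (1ℤ ℤ.+ e ℤ.* D) ℤ.- f ℤ.* D ℤ.* d)
          ≡⟨ first t y e f d D ⟩
        q ℤ.* D ℤ.+ y ∎
      regroup : ∀ q D y j δ → (q ℤ.+ j) ℤ.* D ℤ.+ (y ℤ.+ j ℤ.* δ) ≡ (q ℤ.* D ℤ.+ y) ℤ.+ j ℤ.* (D ℤ.+ δ)
      regroup = solve-∀
      collect : ∀ t i j d → (t ℤ.+ i ℤ.* d) ℤ.+ j ℤ.* d ≡ t ℤ.+ (i ℤ.+ j) ℤ.* d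
      collect = solve-∀
      position : ∀ j → + x j ≡ y ℤ.+ + j ℤ.* δ →
                 (q ℤ.+ + j) ℤ.* D ℤ.+ + x j ≡ t ℤ.+ + (i + j) ℤ.* d
      position j xj≡ = begin
        (q ℤ.+ + j) ℤ.* D ℤ.+ + x j                ≡⟨ cong (ℤ._+_ ((q ℤ.+ + j) ℤ.* D)) xj≡ ⟩
        (q ℤ.+ + j) ℤ.* D ℤ.+ (y ℤ.+ + j ℤ.* δ)    ≡⟨ regroup q D y (+ j) δ ⟩
        (q ℤ.* D ℤ.+ y) ℤ.+ + j ℤ.* (D ℤ.+ δ)      ≡⟨ cong₂ (λ s d → s ℤ.+ + j ℤ.* d) (sym start) (sym d≡) ⟩
        (t ℤ.+ + i ℤ.* d) ℤ.+ + j ℤ.* d            ≡⟨ collect t (+ i) (+ j) d ⟩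
        t ℤ.+ + (i + j) ℤ.* d ∎

    -- The short progression of `a`, which `bound` places inside ϱᵐ(v 0), supplies the positions
    -- `x j`; for the difference Qᵐ - n it is read backwards. If `c` inverts `n` modulo Qᵐ, then `c`
    -- inverts Qᵐ + n and `- c` inverts Qᵐ - n.
    no-long-progressions : ∀ {a n} → Coprime n Q → ∀ t →
      (∀ j → j ≤ k → v (+ (t + j * n)) ≡ a) → ∀ m → t + k * n < Q ^ m →
      ¬ HasProgression v a (+ (Q ^ m) ℤ.+ + n) (Q ^ m + k) ×
      ¬ HasProgression v a (+ (Q ^ m) ℤ.- + n) (Q ^ m + k)
    no-long-progressions {a} {n} coprime t eq m bound
      with c , e , inverse ← inverse-modulo-power coprime m
      = no-long-progression m (D ℤ.+ + n) (+ n) c (e ℤ.+ c) refl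
          (trans (plus c D (+ n)) (trans (cong (ℤ._+_ (c ℤ.* D)) inverse) (gather⁺ c D e)))
          (λ j → t + j * n) (+ t)
          (λ j j≤k → in-block j j≤k , cong (ℤ._+_ (+ t)) (ℤ.pos-* j n) , eq j j≤k)
      , no-long-progression m (D ℤ.- + n) (ℤ.- + n) (ℤ.- c) (e ℤ.- c) refl
          (trans (minus c D (+ n)) (trans (cong (λ z → z ℤ.- c ℤ.* D) inverse) (gather⁻ c D e)))
          (λ j → t + (k ∸ j) * n) (+ (t + k * n))
          (λ j j≤k → in-block (k ∸ j) (ℕ.m∸n≤m k j) , reversed j j≤k , eq (k ∸ j) (ℕ.m∸n≤m k j))
      where
      D = + (Q ^ m)
      in-block : ∀ j → j ≤ k → t + j * n < Q ^ m
      in-block j j≤k = ℕ.≤-<-trans (ℕ.+-monoʳ-≤ t (ℕ.*-monoˡ-≤ n j≤k)) bound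
      plus : ∀ c D n → c ℤ.* (D ℤ.+ n) ≡ c ℤ.* D ℤ.+ c ℤ.* n
      plus = solve-∀
      gather⁺ : ∀ c D e → c ℤ.* D ℤ.+ (1ℤ ℤ.+ e ℤ.* D) ≡ 1ℤ ℤ.+ (e ℤ.+ c) ℤ.* D
      gather⁺ = solve-∀
      minus : ∀ c D n → ℤ.- c ℤ.* (D ℤ.- n) ≡ c ℤ.* n ℤ.- c ℤ.* D
      minus = solve-∀
      gather⁻ : ∀ c D e → (1ℤ ℤ.+ e ℤ.* D) ℤ.- c ℤ.* D ≡ 1ℤ ℤ.+ (e ℤ.- c) ℤ.* D
      gather⁻ = solve-∀
      telescope : ∀ t x y n → t ℤ.+ x ℤ.* n ≡ t ℤ.+ (y ℤ.+ x) ℤ.* n ℤ.+ y ℤ.* ℤ.- n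
      telescope = solve-∀
      reversed : ∀ j → j ≤ k → + (t + (k ∸ j) * n) ≡ + (t + k * n) ℤ.+ + j ℤ.* ℤ.- + n
      reversed j j≤k = begin
        + t ℤ.+ + ((k ∸ j) * n)
          ≡⟨ cong (ℤ._+_ (+ t)) (ℤ.pos-* (k ∸ j) n) ⟩
        + t ℤ.+ + (k ∸ j) ℤ.* + n
          ≡⟨ telescope (+ t) (+ (k ∸ j)) (+ j) (+ n) ⟩
        + t ℤ.+ + (j + (k ∸ j)) ℤ.* + n ℤ.+ + j ℤ.* ℤ.- + n
          ≡⟨ cong (λ z → + t ℤ.+ + z ℤ.* + n ℤ.+ + j ℤ.* ℤ.- + n) (ℕ.m+[n∸m]≡n j≤k) ⟩
        + t ℤ.+ + k ℤ.* + n ℤ.+ + j ℤ.* ℤ.- + n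
          ≡⟨ cong (λ z → + t ℤ.+ z ℤ.+ + j ℤ.* ℤ.- + n) (ℤ.pos-* k n) ⟨
        + (t + k * n) ℤ.+ + j ℤ.* ℤ.- + n ∎
        where open ≡-Reasoning

-- Progressions and the measure of C_{n,a}

module _ {A : Set} (_≟_ : DecidableEquality A) (v : ℤ → A) (repetitive : IsRepetitive v)
         (μ : ProbabilityMeasure (Cylinder v)) (k n : ℕ) (a : A) where

  private
    shifted : ℕ → OrbitClosure v → OrbitClosure v
    shifted zero    u = u
    shifted (suc p) u = shifted p (T v u)

    shifted-at : ∀ p u i → proj₁ (shifted p u) i ≡ proj₁ u (i ℤ.+ + p)
    shifted-at zero    u i = cong (proj₁ u) (sym (ℤ.+-identityʳ i))
    shifted-at (suc p) u i = trans (shifted-at p (T v u) i) (cong (proj₁ u) (reassociate i (+ p)))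
      where
      reassociate : ∀ i p → i ℤ.+ p ℤ.+ 1ℤ ≡ i ℤ.+ (1ℤ ℤ.+ p)
      reassociate = solve-∀

    preimage : ∀ p → Borel v (C v k n a ∘ shifted p)
    preimage zero    = C-borel v k n a
    preimage (suc p) = T⁻¹-borel v (preimage p)

    measure-preimage : IsShiftInvariant v μ → ∀ p →
                       seq (measure μ (preimage p)) ≼ seq (measure μ (C-borel v k n a))
    measure-preimage invariant zero    = ≼-refl
    measure-preimage invariant (suc p) =
      ≼-trans (≼⁺ (proj₁ (invariant (preimage p)))) (measure-preimage invariant p)

    C? : Decidable (C v k n a)
    C? u with ℕ.allUpTo? (λ j → proj₁ u (+ (j * n)) ≟ a) (suc k)
    ... | yes all = yes λ j j≤k → all (s≤s j≤k)
    ... | no ¬all = no λ all → ¬all λ j<1+k → all _ (ℕ.≤-pred j<1+k)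

  -- The progression recurs in `v` with gaps bounded by `R`, so every point of the orbit closure
  -- enters C under one of the shifts by 0, ..., R. These R + 1 preimages cover the space and each
  -- has at most the measure of C.
  progression⇒positive : IsShiftInvariant v μ →
                         HasProgression v a (+ n) (suc k) → 0ℝ <ℝ measure μ (C-borel v k n a)
  progression⇒positive invariant (t , eq) with R , recurs ← repetitive t (suc (k * n)) =
    1≼multiple⇒positive (suc R) (≼-trans
      (measure-cover μ preimage (λ p u → C? (shifted p u)) (suc R) covers)
      (partialSum-mono (λ p → measure μ (preimage p)) (λ _ → measure μ (C-borel v k n a)) (suc R)
        λ p _ → measure-preimage invariant p))
    where
    covers : ∀ u → ∃[ p ] (p < suc R × C v k n a (shifted p u))
    -- The radius k n + R contains every position `i * n + p′` read after a shift by `p′` ≤ R.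
    covers u@(u′ , u∈) with j , agree ← u∈ (k * n + R) with recurs j
    ... | p , j≤p , p≤j+R , same = p′ , s≤s p′≤R , λ i i≤k → begin
      proj₁ (shifted p′ u) (+ (i * n))     ≡⟨ shifted-at p′ u (+ (i * n)) ⟩
      u′ (+ (i * n + p′))                  ≡⟨ agree (+ (i * n + p′)) (ℕ.+-mono-≤ (ℕ.*-monoˡ-≤ n i≤k) p′≤R) ⟩
      v (+ (i * n + p′) ℤ.+ j)             ≡⟨ cong (λ x → v (+ (i * n) ℤ.+ x ℤ.+ j)) p′≡ ⟩
      v (+ (i * n) ℤ.+ (p ℤ.- j) ℤ.+ j)    ≡⟨ cong v (cancel (+ (i * n)) p j) ⟩
      v (p ℤ.+ + (i * n))                  ≡⟨ same (i * n) (s≤s (ℕ.*-monoˡ-≤ n i≤k)) ⟩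
      v (t ℤ.+ + (i * n))                  ≡⟨ cong (λ x → v (t ℤ.+ x)) (ℤ.pos-* i n) ⟩
      v (t ℤ.+ + i ℤ.* + n)                ≡⟨ eq i (s≤s i≤k) ⟩
      a                                    ∎
      where
      open ≡-Reasoning
      p′ = ∣ p ℤ.- j ∣
      p′≡ : + p′ ≡ p ℤ.- j
      p′≡ = ℤ.0≤i⇒+∣i∣≡i (ℤ.i≤j⇒0≤j-i j≤p)
      cancel : ∀ x p j → x ℤ.+ (p ℤ.- j) ℤ.+ j ≡ p ℤ.+ x
      cancel = solve-∀
      drop : ∀ j R → j ℤ.+ R ℤ.- j ≡ R
      drop = solve-∀
      p′≤R : p′ ≤ R
      p′≤R = ℤ.drop‿+≤+ (subst₂ ℤ._≤_ (sym p′≡) (drop j (+ R)) (ℤ.+-monoˡ-≤ (ℤ.- j) p≤j+R))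

  -- A point of C agrees with a translate of `v` on the window of radius k n and so exhibits a
  -- progression in `v`. If there is none, C is empty and has measure zero.
  positive⇒progression : Dec (HasProgression v a (+ n) (suc k)) →
                         0ℝ <ℝ measure μ (C-borel v k n a) → HasProgression v a (+ n) (suc k)
  positive⇒progression (yes progression) _ = progression
  positive⇒progression (no none) positive =
    ⊥-elim (<ℝ⇒⋠ 0ℝ (measure μ (C-borel v k n a)) positive
      (measure-empty μ (C-borel v k n a) λ {(u , u∈)} u∈C →
        let j , agree = u∈ (k * n)
        in none (j , λ i i<L → trans
             (cong v (trans (cong (ℤ._+_ j) (sym (ℤ.pos-* i n))) (ℤ.+-comm j (+ (i * n)))))
             (trans (sym (agree (+ (i * n)) (ℕ.*-monoˡ-≤ n (ℕ.≤-pred i<L))))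
               (u∈C i (ℕ.≤-pred i<L))))))

-- Assembly of the statements on measures and on long progressions.

theorem35 : ∀ {A : Set} {r : ℕ} → A ↔ Fin r →
    ∀ {Q : ℕ} → 2 ≤ Q →
    ∀ (ϱ : Substitution A Q) → IsPrimitive ϱ → IsBijective ϱ →
    ∀ (k : ℕ) → 1 ≤ k → (∀ a → ¬ InLanguage ϱ (replicate (suc k) a)) →
    ∀ (v : ℤ → A) → IsRepetitive v → IsFixedPoint ϱ v →
    (∀ (μ : ProbabilityMeasure (Cylinder v)) → IsShiftInvariant v μ →
    ( (∃[ n ] ∃[ a ] (0 < n × 0ℝ <ℝ measure μ (C-borel v k n a)))
    × (∀ n a → 0 < n → 0ℝ <ℝ measure μ (C-borel v k n a) →
    ∀ s n′ → 0 < n′ → n ≡ Q ^ s * n′ →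
    ∃[ b ] (0ℝ <ℝ measure μ (C-borel v k n′ b)))
    × (∀ n a → 0 < n → 0ℝ <ℝ measure μ (C-borel v k n a) →
    ∀ m → (∀ c b → b ∈ power ϱ m c) →
    ∀ b → 0ℝ <ℝ measure μ (C-borel v k (Q ^ m * n) b)) )
    ×
    (∀ a n → 0 < n → 0ℝ <ℝ measure μ (C-borel v k n a) → Coprime n Q →
    ∃[ m₀ ] (0 < m₀ × (∀ m → m₀ < m →
    ¬ HasProgression v a (+ (Q ^ m) ℤ.+ + n) (Q ^ m + k) ×
    ¬ HasProgression v a (+ (Q ^ m) ℤ.- + n) (Q ^ m + k)))))
    ×
    (r ≡ 2 →
    ∃[ n ] ∃[ m₀ ] (0 < n × 0 < m₀ × (∀ s m → m₀ ≤ m → ∀ a →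
    ¬ HasProgression v a (+ (Q ^ (m + s)) ℤ.+ + (Q ^ s * n)) (Q ^ m + k) ×
    ¬ HasProgression v a (+ (Q ^ (m + s)) ℤ.- + (Q ^ s * n)) (Q ^ m + k))))
theorem35 {A} A↔Fin {Q} 2≤Q ϱ prim bijective k 1≤k no-power v repetitive fixed =
  (λ μ invariant →
    let toPositive : ∀ {n a} → HasProgression v a (+ n) (suc k) → 0ℝ <ℝ measure μ (C-borel v k n a)
        toPositive {n} {a} = progression⇒positive _≟_ v repetitive μ k n a invariant
        fromPositive : ∀ {n a} → 0ℝ <ℝ measure μ (C-borel v k n a) → HasProgression v a (+ n) (suc k)
        fromPositive {n} {a} = positive⇒progression _≟_ v repetitive μ k n a (progression? a n (suc k))
    in ( (difference , v 0ℤ , difference-pos , toPositive progression)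
       , (λ n a _ positive s n′ _ n≡ →
           let b , progression = desubstitute s (+ n′) (suc k)
                 (subst (λ d → HasProgression v a d (suc k))
                        (trans (cong +_ n≡) (ℤ.pos-* (Q ^ s) n′)) (fromPositive positive))
           in b , toPositive progression)
       , (λ n a _ positive m full b → toPositive
           (subst (λ d → HasProgression v b d (suc k)) (sym (ℤ.pos-* (Q ^ m) n))
             (substitute m (+ n) (suc k) (s≤s z≤n) (full a b) (fromPositive positive)))))
     , (λ a n _ positive coprime →
          let t , eq = progression-from-ℕ v repetitive n (suc k) (fromPositive positive)
          -- For m beyond this bound, t + k n < m < Qᵐ, so the short progression fits into ϱᵐ(v 0).
          in suc (t + k * n) , s≤s z≤n , λ m m₀<m →
             no-long coprime t (λ j j≤k → eq j (s≤s j≤k)) m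
               (ℕ.<-trans (ℕ.n<1+n (t + k * n)) (ℕ.<-trans m₀<m (n<m^n 2≤Q m)))))
  -- The factor Qˢ is removed by `desubstitute`, which may change the letter; therefore `none` is
  -- established for all letters with the same bound `m₀`.
  , (λ _ → difference , m₀ , difference-pos , s≤s z≤n , λ s m m₀≤m a →
       (λ progression →
         let b , progression′ = desubstitute s (+ (Q ^ m) ℤ.+ + difference) (Q ^ m + k)
               (subst (λ d → HasProgression v a d (Q ^ m + k)) (scale⁺ s m) progression)
         in proj₁ (none m m₀≤m b) progression′)
     , (λ progression →
         let b , progression′ = desubstitute s (+ (Q ^ m) ℤ.- + difference) (Q ^ m + k)
               (subst (λ d → HasProgression v a d (Q ^ m + k)) (scale⁻ s m) progression)
         in proj₂ (none m m₀≤m b) progression′))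
  where
  open FixedPoint 2≤Q ϱ v fixed
  open Columns bijective
  open Finite A↔Fin k
  open Recurrence 1≤k prim

  _≟_ : DecidableEquality A
  _≟_ = via-injection (↔⇒↣ A↔Fin) Fin._≟_

  no-long : ∀ {a n} → Coprime n Q → ∀ t →
            (∀ j → j ≤ k → v (+ (t + j * n)) ≡ a) → ∀ m → t + k * n < Q ^ m →
            ¬ HasProgression v a (+ (Q ^ m) ℤ.+ + n) (Q ^ m + k) ×
            ¬ HasProgression v a (+ (Q ^ m) ℤ.- + n) (Q ^ m + k)
  no-long = no-long-progressions v repetitive 2≤Q ϱ fixed bijective no-power

  v-progression-from : ∀ x j → j ≤ k → v (+ (x * blockLength + j * difference)) ≡ v (+ x)
  v-progression-from x j j≤k =
    trans (cong (λ t → v (t ℤ.+ + (j * difference))) (ℤ.pos-* x blockLength))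
          (v-progression (+ x) j j≤k)

  progression : HasProgression v (v 0ℤ) (+ difference) (suc k)
  progression = 0ℤ , λ i i<1+k →
    trans (cong v (trans (ℤ.+-identityˡ (+ i ℤ.* + difference)) (sym (ℤ.pos-* i difference))))
          (v-progression-from 0 i (ℕ.≤-pred i<1+k))

  -- Each letter occurs at some x < `letterBound`, and its progression starts at `x * blockLength`;
  -- this bound serves all letters at once.
  m₀ : ℕ
  m₀ = suc (letterBound * blockLength + k * difference)

  none : ∀ m → m₀ ≤ m → ∀ a →
         ¬ HasProgression v a (+ (Q ^ m) ℤ.+ + difference) (Q ^ m + k) ×
         ¬ HasProgression v a (+ (Q ^ m) ℤ.- + difference) (Q ^ m + k)
  none m m₀≤m a with x , x< , vx≡a ← letter-occurs a =
    no-long (difference-coprime 1≤k) (x * blockLength)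
      (λ j j≤k → trans (v-progression-from x j j≤k) vx≡a) m
      (ℕ.≤-<-trans (ℕ.+-monoˡ-≤ (k * difference) (ℕ.*-monoˡ-≤ blockLength (ℕ.<⇒≤ x<)))
        (ℕ.<-trans m₀≤m (n<m^n 2≤Q m)))

  split : ∀ s m → + (Q ^ (m + s)) ≡ + (Q ^ s) ℤ.* + (Q ^ m)
  split s m = trans (cong +_ (trans (cong (Q ^_) (ℕ.+-comm m s)) (ℕ.^-distribˡ-+-* Q s m)))
                    (ℤ.pos-* (Q ^ s) (Q ^ m))

  scale⁺ : ∀ s m → + (Q ^ (m + s)) ℤ.+ + (Q ^ s * difference) ≡
                   + (Q ^ s) ℤ.* (+ (Q ^ m) ℤ.+ + difference)
  scale⁺ s m = trans (cong₂ ℤ._+_ (split s m) (ℤ.pos-* (Q ^ s) difference))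
                     (sym (ℤ.*-distribˡ-+ (+ (Q ^ s)) (+ (Q ^ m)) (+ difference)))

  scale⁻ : ∀ s m → + (Q ^ (m + s)) ℤ.- + (Q ^ s * difference) ≡
                   + (Q ^ s) ℤ.* (+ (Q ^ m) ℤ.- + difference)
  scale⁻ s m = trans (cong₂ ℤ._-_ (split s m) (ℤ.pos-* (Q ^ s) difference))
                     (factor (+ (Q ^ s)) (+ (Q ^ m)) (+ difference))
    where
    factor : ∀ x y z → x ℤ.* y ℤ.- x ℤ.* z ≡ x ℤ.* (y ℤ.- z)
    factor = solve-∀
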